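{- There is an absolute constant $c>0$ such that for all sufficiently large $n$ there is a probability distribution over instances (sequences of $2n$ insertions, exactly $n$ of which increment $p$ and $n$ of which increment $q$, starting from $p=q=0$) such that for every family of bijections $(f_{p,q})$, the expected total cost over a random instance from this distribution is at least $c\, n\log n/\log\log n$; i.e., the expected amortized cost per insertion is $\Omega(\log n/\log\log n)$.
   Context: Balls-to-bins problem: the state is $(p,q)$; there are balls $a_1,\dots,a_p,b_1,\dots,b_q$ and bins $1,\dots,p+q$, and the placement is a bijection $f_{p,q}$ from balls to bins depending only on $(p,q)$. An insertion increments $p$ (creating ball $a_{p+1}$) or $q$ (creating ball $b_{q+1}$) together with a new bin, and the placement switches to the new bijection. The cost of an insertion is the number of balls whose bin changes (relocated balls). This is the special case of the two-way adapter problem where only allocations occur. -}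

module Defs where

open import Algebra.Definitions.RawSemiring using () renaming (_^_ to power)
open import Data.Fin.Base using (Fin; toℕ; inject₁)
open import Data.Integer.Base as ℤ using (ℤ; +_; -[1+_])
open import Data.List.Base using (List; []; _∷_; _++_; map; allFin; filter; length; foldr)
open import Data.List.Relation.Unary.All using (All)
open import Data.Nat.Base as ℕ using (ℕ; suc)
import Data.Nat.Properties as ℕ
open import Data.Product.Base using (_×_; _,_; proj₁)
open import Data.Rational.Base
  using (ℚ; 0ℚ; 1ℚ; ½; _+_; _*_; _/_; _≤_; ↥_; ↧ₙ_; +-*-rawSemiring)
open import Data.Sum.Base as Sum using (_⊎_; inj₁; inj₂)
open import Data.Vec.Base as Vec using (Vec; count)
open import Function.Base using (id)
open import Function.Bundles using (_⤖_; Bijection)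
open import Relation.Binary.Definitions using (DecidableEquality)
open import Relation.Binary.PropositionalEquality.Core using (_≡_; refl)
open import Relation.Nullary.Decidable.Core using (yes; no; ¬?)

------------------------------------------------------------------------
-- Balls to bins

-- The pair (p , q).
State : Set
State = ℕ × ℕ

Ball : State → Set
Ball (p , q) = Fin p ⊎ Fin q

Bin : State → Set
Bin (p , q) = Fin (p ℕ.+ q)

balls : (s : State) → List (Ball s)
balls (p , q) = map inj₁ (allFin p) ++ map inj₂ (allFin q)

Placement : Set
Placement = (s : State) → Ball s ⤖ Bin s

-- Bins of different states are compared by their number.
bin : Placement → (s : State) → Ball s → ℕ
bin f s b = toℕ (Bijection.to (f s) b)

data Insertion : Set where
  insertA insertB : Insertion

infix 4 _≟_
_≟_ : DecidableEquality Insertion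
insertA ≟ insertA = yes refl
insertA ≟ insertB = no λ ()
insertB ≟ insertA = no λ ()
insertB ≟ insertB = yes refl

insert : Insertion → State → State
insert insertA (p , q) = suc p , q
insert insertB (p , q) = p , suc q

-- An old ball, seen as a ball of the next state; it keeps its index.
old : (i : Insertion) (s : State) → Ball s → Ball (insert i s)
old insertA _ = Sum.map inject₁ id
old insertB _ = Sum.map id inject₁

-- Only balls present before the insertion can be relocated, so the
-- newly created ball is not charged.
cost : Placement → Insertion → State → ℕ
cost f i s =
  length (filter (λ b → ¬? (bin f (insert i s) (old i s b) ℕ.≟ bin f s b)) (balls s))

costFrom : Placement → State → List Insertion → ℕ
costFrom f s []       = 0
costFrom f s (i ∷ is) = cost f i s ℕ.+ costFrom f (insert i s) is

record Instance (n : ℕ) : Set where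
  field
    insertions : Vec Insertion (2 ℕ.* n)
    countA     : count (insertA ≟_) insertions ≡ n
    countB     : count (insertB ≟_) insertions ≡ n

totalCost : ∀ {n} → Placement → Instance n → ℕ
totalCost f I = costFrom f (0 , 0) (Vec.toList (Instance.insertions I))

------------------------------------------------------------------------
-- Finitely supported probability distributions

fromℕ : ℕ → ℚ
fromℕ n = + n / 1

sum : List ℚ → ℚ
sum = foldr _+_ 0ℚ

-- Each entry is an outcome together with its probability; an outcome
-- listed several times has the sum of the listed probabilities.
record Distribution (A : Set) : Set where
  field
    outcomes    : List (ℚ × A)
    nonNegative : All (λ (w , _) → 0ℚ ≤ w) outcomes
    total       : sum (map proj₁ outcomes) ≡ 1ℚ

expectation : ∀ {A} → Distribution A → (A → ℕ) → ℚ
expectation μ X = sum (map (λ (w , x) → w * fromℕ (X x)) (Distribution.outcomes μ))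

------------------------------------------------------------------------
-- Logarithms, given by their rational lower and upper bounds

infixr 8 _^_
_^_ : ℚ → ℕ → ℚ
_^_ = power +-*-rawSemiring

2^_ : ℤ → ℚ
2^ (+ k)    = fromℕ 2 ^ k
2^ -[1+ k ] = ½ ^ suc k

-- For x > 0 and r = i / d with d > 0, the real inequality r ≤ log₂ x
-- says 2^(i/d) ≤ x, that is, 2^i ≤ x^d; and dually.
infix 4 _≤log₂_ log₂_≤_
_≤log₂_ : ℚ → ℚ → Set
r ≤log₂ x = 2^ (↥ r) ≤ x ^ ↧ₙ r

log₂_≤_ : ℚ → ℚ → Set
log₂ x ≤ r = x ^ ↧ₙ r ≤ 2^ (↥ r)

-- For n ≥ 3, c ≥ 0 and e ≥ 0: the real inequality
--   c · n · log₂ n / log₂ (log₂ n) ≤ e.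
-- Multiplied by log₂ (log₂ n) > 0, it reads
-- c · n · log₂ n ≤ e · log₂ (log₂ n).  Here u ranges over the rational
-- lower bounds of log₂ n, whose supremum is log₂ n, and v over rational
-- upper bounds of log₂ (log₂ n), whose infimum is log₂ (log₂ n): every
-- v > log₂ (log₂ n) occurs, as there is a rational w with
-- log₂ n ≤ w ≤ 2^v.
infix 4 _·nlog/loglog_≤_
_·nlog/loglog_≤_ : ℚ → ℕ → ℚ → Set
c ·nlog/loglog n ≤ e =
  ∀ (u w v : ℚ) → u ≤log₂ fromℕ n → log₂ fromℕ n ≤ w → log₂ w ≤ v →
  c * fromℕ n * u ≤ e * v

{-# OPTIONS --safe #-}

-- Words of insertions are built recursively from 4L rounds, whose words
-- have a small surplus of insertions a in the first half of the rounds
-- and of insertions b in the second half, or the other way round,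
-- depending on a random bit per level. Both orders end in the same state,
-- hence with the same placement, but most balls arrive in different
-- rounds. Label each ball of the final state by the round of its last
-- relocation. If few balls are relocated in two different rounds, this
-- label is determined, up to these few exceptions, by the ball (the round
-- of its arrival or first relocation) and also by its bin (the round of
-- its creation or first change of content). Counting the balls whose
-- labels agree in both orders, once over balls and once over bins, the
-- old balls and their original bins cancel; every new bin has the same
-- creation round in both orders, but few new balls have the same arrival
-- round. So a constant fraction of the balls is relocated in two
-- different rounds. Such a relocation does not count within its own
-- round, where only balls created or relocated earlier in the round are
-- charged, so the L levels add up to L/8 relocations per ball. Finally
-- L is a power of two with 2L (4L)^L ≤ 2n, so L ~ log n / log log n.
module Submission where

import Defs
open import Defs hiding (sum; _^_)
open import Algebra.Bundles using (CommutativeMonoid)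
open import Data.Bool.Base as 𝔹 using (Bool; true; false; not; _∧_; _∨_; if_then_else_)
open import Data.Bool.Properties using (∧-conicalˡ; ∧-conicalʳ; ∧-identityʳ; ∨-identityʳ; ∨-zeroʳ)
open import Data.Fin.Base using (Fin; zero; suc; toℕ; fromℕ<; splitAt; _↑ˡ_; _↑ʳ_)
open import Data.Fin.Properties
  using (toℕ<n; toℕ-inject₁; toℕ-fromℕ<; fromℕ<-toℕ; +↔⊎; splitAt-↑ˡ; splitAt-↑ʳ)
open import Data.Integer.Base as ℤ using (-[1+_]; +≤+; -≤+) renaming (+_ to +ᶻ_)
import Data.Integer.Properties as ℤₚ
open import Data.List.Base using (List; []; _∷_; _++_; filter; length; map; replicate; tabulate)
open import Data.List.Properties using (filter-++; length-++; map-++; map-tabulate)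
open import Data.List.Relation.Unary.All using (All; []; _∷_)
open import Data.List.Relation.Unary.All.Properties using (++⁺)
open import Data.Nat.Base
  using (ℕ; zero; suc; pred; NonZero; _+_; _*_; _∸_; _^_; _/_; _%_; _⊓_; _≤_; _<_; _≡ᵇ_; _<ᵇ_; z≤n; s≤s)
open import Data.Nat.DivMod using (m≡m%n+[m/n]*n; m%n<n; m≥n⇒m/n>0)
open import Data.Nat.Properties as ℕₚ hiding (_≟_)
open import Data.Nat.Solver using (module +-*-Solver)
open import Data.Product.Base using (_×_; _,_; proj₁; proj₂; Σ-syntax; ∃-syntax)
open import Data.Rational.Base as ℚ using (ℚ; mkℚ; 0ℚ; 1ℚ; ½; *≤*)
open import Data.Rational.Literals using (fromℤ)
import Data.Rational.Properties as ℚₚ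
import Data.Rational.Solver as ℚ-Solver
open import Data.Sum.Base using (inj₁; inj₂)
open import Data.Unit.Base using (tt)
open import Data.Vec.Base using (Vec; []; _∷_; cast; count; fromList; toList)
open import Data.Vec.Properties using (toList-cast; toList∘fromList)
open import Function.Base using (_∘_; id)
open import Function.Bundles using (Bijection; Inverse; _↔_)
open import Function.Construct.Composition using (_↔-∘_)
open import Function.Properties.Bijection using (⤖⇒↔)
open import Relation.Binary.PropositionalEquality
open import Relation.Nullary using (¬_; Dec; yes; no; does; contradiction)
open import Relation.Nullary.Decidable using (toWitness; ¬?)
open import Relation.Unary using (Decidable)
open import Algebra.Properties.CommutativeMonoid.Sum +-0-commutativeMonoid
  using (sum-permute; sum-cong-≗) renaming (sum to sumᶠ)
open import Algebra.Properties.CommutativeSemigroup +-commutativeSemigroup using (interchange)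

-- Finite sums

∑ : ℕ → (ℕ → ℕ) → ℕ
∑ zero    g = 0
∑ (suc n) g = ∑ n g + g n

∑-mono : ∀ n {g k : ℕ → ℕ} → (∀ i → i < n → g i ≤ k i) → ∑ n g ≤ ∑ n k
∑-mono zero    h = z≤n
∑-mono (suc n) h = +-mono-≤ (∑-mono n (λ i i<n → h i (m≤n⇒m≤1+n i<n))) (h n ≤-refl)

∑-cong : ∀ n {g k : ℕ → ℕ} → (∀ i → i < n → g i ≡ k i) → ∑ n g ≡ ∑ n k
∑-cong n h = ≤-antisym (∑-mono n (λ i l → ≤-reflexive (h i l)))
                       (∑-mono n (λ i l → ≤-reflexive (sym (h i l))))

∑-+ : ∀ n (g k : ℕ → ℕ) → ∑ n (λ i → g i + k i) ≡ ∑ n g + ∑ n k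
∑-+ zero    g k = refl
∑-+ (suc n) g k = trans (cong (_+ (g n + k n)) (∑-+ n g k)) (interchange (∑ n g) (∑ n k) (g n) (k n))

∑-const : ∀ n c → ∑ n (λ _ → c) ≡ n * c
∑-const zero    c = refl
∑-const (suc n) c = trans (cong (_+ c) (∑-const n c)) (+-comm (n * c) c)

∑-* : ∀ n c g → ∑ n (λ i → c * g i) ≡ c * ∑ n g
∑-* zero    c g = sym (*-zeroʳ c)
∑-* (suc n) c g = trans (cong (_+ c * g n) (∑-* n c g)) (sym (*-distribˡ-+ c (∑ n g) (g n)))

∑-split : ∀ m n g → ∑ (m + n) g ≡ ∑ m g + ∑ n (λ i → g (m + i))
∑-split m zero    g = trans (cong (λ k → ∑ k g) (+-identityʳ m)) (sym (+-identityʳ _))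
∑-split m (suc n) g = trans (cong (λ k → ∑ k g) (+-suc m n))
  (trans (cong (_+ g (m + n)) (∑-split m n g)) (+-assoc (∑ m g) _ _))

∑-≤ : ∀ {m n} g → m ≤ n → ∑ m g ≤ ∑ n g
∑-≤ {m} {n} g m≤n = subst (λ k → ∑ m g ≤ ∑ k g) (m+[n∸m]≡n m≤n)
  (≤-trans (m≤m+n _ _) (≤-reflexive (sym (∑-split m (n ∸ m) g))))

∑-vanish : ∀ {m n} g → m ≤ n → (∀ i → m ≤ i → i < n → g i ≡ 0) → ∑ n g ≤ ∑ m g
∑-vanish {m} {zero}  g m≤n h = z≤n
∑-vanish {m} {suc n} g m≤n h with m≤n⇒m<n∨m≡n m≤n
... | inj₂ refl      = ≤-refl
... | inj₁ (s≤s m≤n′) =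
  ≤-trans (+-mono-≤ (∑-vanish g m≤n′ (λ i a b → h i a (m≤n⇒m≤1+n b)))
                    (≤-reflexive (h n m≤n′ ≤-refl)))
          (≤-reflexive (+-identityʳ _))

∑-suc : ∀ n g → ∑ (suc n) g ≡ g 0 + ∑ n (g ∘ suc)
∑-suc zero    g = sym (+-identityʳ (g 0))
∑-suc (suc n) g = trans (cong (_+ g (suc n)) (∑-suc n g)) (+-assoc (g 0) _ _)

∑≡sum : ∀ n g → ∑ n g ≡ sumᶠ {n} (g ∘ toℕ)
∑≡sum zero    g = refl
∑≡sum (suc n) g = trans (∑-suc n g) (cong (g 0 +_) (∑≡sum n (g ∘ suc)))

sum-↑ : ∀ m n (g : Fin (m + n) → ℕ) →
        sumᶠ g ≡ sumᶠ (g ∘ (_↑ˡ n)) + sumᶠ (g ∘ (m ↑ʳ_))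
sum-↑ zero    n g = refl
sum-↑ (suc m) n g = trans (cong (g zero +_) (sum-↑ m n (g ∘ suc))) (sym (+-assoc (g zero) _ _))

⟦_⟧ : Bool → ℕ
⟦ false ⟧ = 0
⟦ true  ⟧ = 1

-- Balls of all states

-- The ball insertA , i is a_{i+1}, the ball insertB , i is b_{i+1}.
Label : Set
Label = Insertion × ℕ

size : State → Insertion → ℕ
size (p , q) insertA = p
size (p , q) insertB = q

#bins : State → ℕ
#bins (p , q) = p + q

Live : State → Label → Set
Live s (k , i) = i < size s k

infix 4 _⊑_
_⊑_ : State → State → Set
s ⊑ t = ∀ k → size s k ≤ size t k

⊑-size : ∀ {s t} → s ⊑ t → #bins s ≤ #bins t
⊑-size h = +-mono-≤ (h insertA) (h insertB)

Live-⊑ : ∀ {s t} → s ⊑ t → ∀ y → Live s y → Live t y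
Live-⊑ h (k , i) l = ≤-trans l (h k)

⊑-insert : ∀ i s → s ⊑ insert i s
⊑-insert insertA (p , q) insertA = n≤1+n p
⊑-insert insertA (p , q) insertB = ≤-refl
⊑-insert insertB (p , q) insertA = ≤-refl
⊑-insert insertB (p , q) insertB = n≤1+n q

⊑-refl : ∀ {s} → s ⊑ s
⊑-refl k = ≤-refl

⊑-trans : ∀ {s t u} → s ⊑ t → t ⊑ u → s ⊑ u
⊑-trans g h k = ≤-trans (g k) (h k)

∑ᵇ : State → (Label → ℕ) → ℕ
∑ᵇ s F = ∑ (size s insertA) (λ i → F (insertA , i)) + ∑ (size s insertB) (λ i → F (insertB , i))

∑ᵇ-mono : ∀ s {F G : Label → ℕ} → (∀ y → Live s y → F y ≤ G y) → ∑ᵇ s F ≤ ∑ᵇ s G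
∑ᵇ-mono s h = +-mono-≤ (∑-mono _ (λ i → h (insertA , i))) (∑-mono _ (λ i → h (insertB , i)))

∑ᵇ-cong : ∀ s {F G : Label → ℕ} → (∀ y → Live s y → F y ≡ G y) → ∑ᵇ s F ≡ ∑ᵇ s G
∑ᵇ-cong s h = cong₂ _+_ (∑-cong _ (λ i → h (insertA , i))) (∑-cong _ (λ i → h (insertB , i)))

∑ᵇ-+ : ∀ s (F G : Label → ℕ) → ∑ᵇ s (λ y → F y + G y) ≡ ∑ᵇ s F + ∑ᵇ s G
∑ᵇ-+ s F G = trans (cong₂ _+_ (∑-+ (size s insertA) _ _) (∑-+ (size s insertB) _ _))
  (interchange (∑ (size s insertA) (λ i → F (insertA , i))) _ _ _)

∑ᵇ-⊑ : ∀ {s t} F → s ⊑ t → ∑ᵇ s F ≤ ∑ᵇ t F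
∑ᵇ-⊑ F h = +-mono-≤ (∑-≤ _ (h insertA)) (∑-≤ _ (h insertB))

∑ᵇ-vanish : ∀ {s t} F → s ⊑ t → (∀ y → ¬ Live s y → Live t y → F y ≡ 0) → ∑ᵇ t F ≤ ∑ᵇ s F
∑ᵇ-vanish F h v = +-mono-≤
  (∑-vanish _ (h insertA) (λ i a b → v (insertA , i) (≤⇒≯ a) b))
  (∑-vanish _ (h insertB) (λ i a b → v (insertB , i) (≤⇒≯ a) b))

-- Each ball of `t` that is not in `s` adds at most 1 to the sum. Bin counts stand on both sides so
-- that nothing is subtracted.
∑ᵇ-bounded : ∀ {s t} F → (∀ y → F y ≤ 1) → s ⊑ t → ∑ᵇ t F + #bins s ≤ ∑ᵇ s F + #bins t
∑ᵇ-bounded {s} {t} F F≤1 h = begin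
  ∑ᵇ t F + #bins s ≡⟨ interchange (∑ (size t insertA) (λ i → F (insertA , i))) _ _ _ ⟩
  (∑ (size t insertA) (λ i → F (insertA , i)) + size s insertA)
    + (∑ (size t insertB) (λ i → F (insertB , i)) + size s insertB)
    ≤⟨ +-mono-≤ (one insertA) (one insertB) ⟩
  (∑ (size s insertA) (λ i → F (insertA , i)) + size t insertA)
    + (∑ (size s insertB) (λ i → F (insertB , i)) + size t insertB)
    ≡⟨ interchange (∑ (size s insertA) (λ i → F (insertA , i))) _ _ _ ⟩
  ∑ᵇ s F + #bins t ∎
  where
  open ≤-Reasoning
  aux : ∀ m d g → (∀ i → g i ≤ 1) → ∑ (m + d) g + m ≤ ∑ m g + (m + d)
  aux m d g g≤1 = begin
    ∑ (m + d) g + m                       ≡⟨ cong (_+ m) (∑-split m d g) ⟩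
    ∑ m g + ∑ d (λ i → g (m + i)) + m     ≤⟨ +-monoˡ-≤ m (+-monoʳ-≤ (∑ m g)
      (≤-trans (∑-mono d (λ i _ → g≤1 (m + i))) (≤-reflexive (trans (∑-const d 1) (*-identityʳ d))))) ⟩
    ∑ m g + d + m                         ≡⟨ trans (+-assoc (∑ m g) d m) (cong (∑ m g +_) (+-comm d m)) ⟩
    ∑ m g + (m + d) ∎
  one : ∀ k → ∑ (size t k) (λ i → F (k , i)) + size s k ≤ ∑ (size s k) (λ i → F (k , i)) + size t k
  one k = subst (λ n → ∑ n (λ i → F (k , i)) + size s k ≤ ∑ (size s k) (λ i → F (k , i)) + n)
            (m+[n∸m]≡n (h k)) (aux (size s k) (size t k ∸ size s k) (λ i → F (k , i)) (λ i → F≤1 (k , i)))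

label : ∀ {s} → Ball s → Label
label (inj₁ i) = insertA , toℕ i
label (inj₂ i) = insertB , toℕ i

unlabel : ∀ s y → Live s y → Ball s
unlabel s (insertA , i) l = inj₁ (fromℕ< l)
unlabel s (insertB , i) l = inj₂ (fromℕ< l)

live-label : ∀ {s} (b : Ball s) → Live s (label b)
live-label (inj₁ i) = toℕ<n i
live-label (inj₂ i) = toℕ<n i

unlabel-label : ∀ {s} (b : Ball s) l → unlabel s (label b) l ≡ b
unlabel-label (inj₁ i) l = cong inj₁ (fromℕ<-toℕ i l)
unlabel-label (inj₂ i) l = cong inj₂ (fromℕ<-toℕ i l)

label-unlabel : ∀ s y l → label (unlabel s y l) ≡ y
label-unlabel s (insertA , i) l = cong (insertA ,_) (toℕ-fromℕ< l)
label-unlabel s (insertB , i) l = cong (insertB ,_) (toℕ-fromℕ< l)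

label-old : ∀ i s (b : Ball s) → label (old i s b) ≡ label b
label-old insertA s (inj₁ x) = cong (insertA ,_) (toℕ-inject₁ x)
label-old insertA s (inj₂ x) = refl
label-old insertB s (inj₁ x) = refl
label-old insertB s (inj₂ x) = cong (insertB ,_) (toℕ-inject₁ x)

live? : ∀ s y → Dec (Live s y)
live? s (k , i) = i <? size s k

∑ᵇ-label : ∀ p q (F : Label → ℕ) →
  ∑ᵇ (p , q) F ≡ sumᶠ {p + q} (F ∘ label {p , q} ∘ splitAt p)
∑ᵇ-label p q F = trans
  (cong₂ _+_
    (trans (∑≡sum p _) (sym (sum-cong-≗ {p}
      (λ i → cong (F ∘ label) (splitAt-↑ˡ p i q)))))
    (trans (∑≡sum q _) (sym (sum-cong-≗ {q}
      (λ i → cong (F ∘ label) (splitAt-↑ʳ p q i))))))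
  (sym (sum-↑ p q _))

∑-filter : ∀ {A : Set} {P : A → Set} (P? : Decidable P) n (t : Fin n → A) (g : ℕ → ℕ) →
  (∀ i → g (toℕ i) ≤ ⟦ does (P? (t i)) ⟧) → ∑ n g ≤ length (filter P? (tabulate t))
∑-filter P? zero    t g h = z≤n
∑-filter P? (suc n) t g h = ≤-trans (≤-reflexive (∑-suc n g)) (step (h zero))
  where
  rest = ∑-filter P? n (t ∘ suc) (g ∘ suc) (h ∘ suc)
  step : g 0 ≤ ⟦ does (P? (t zero)) ⟧ →
         g 0 + ∑ n (g ∘ suc) ≤ length (filter P? (tabulate t))
  step h₀ with does (P? (t zero))
  ... | true  = +-mono-≤ h₀ rest
  ... | false = +-mono-≤ h₀ rest

≡ᵇ-true : ∀ m n → (m ≡ᵇ n) ≡ true → m ≡ n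
≡ᵇ-true m n e = ≡ᵇ⇒≡ m n (subst 𝔹.T (sym e) tt)

≡ᵇ-refl : ∀ m → (m ≡ᵇ m) ≡ true
≡ᵇ-refl zero    = refl
≡ᵇ-refl (suc m) = ≡ᵇ-refl m

≡ᵇ-≢ : ∀ m n → m ≢ n → (m ≡ᵇ n) ≡ false
≡ᵇ-≢ m n m≢n with m ≡ᵇ n in e
... | true  = contradiction (≡ᵇ-true m n e) m≢n
... | false = refl

<ᵇ-true : ∀ m n → (m <ᵇ n) ≡ true → m < n
<ᵇ-true m n e = <ᵇ⇒< m n (subst 𝔹.T (sym e) tt)

<⇒<ᵇ≡true : ∀ {m n} → m < n → (m <ᵇ n) ≡ true
<⇒<ᵇ≡true {zero}  (s≤s _) = refl
<⇒<ᵇ≡true {suc m} (s≤s l) = <⇒<ᵇ≡true l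

≮⇒<ᵇ≡false : ∀ {m n} → ¬ m < n → (m <ᵇ n) ≡ false
≮⇒<ᵇ≡false {m} {n} m≮n with m <ᵇ n in e
... | true  = contradiction (<ᵇ-true m n e) m≮n
... | false = refl

-- Positions of balls, contents of bins, and kept balls

module Layout (f : Placement) where

  private
    inv : ∀ s → Bin s → Ball s
    inv s = Inverse.from (⤖⇒↔ (f s))

    to-inv : ∀ s β → Bijection.to (f s) (inv s β) ≡ β
    to-inv s β = Inverse.inverseˡ (⤖⇒↔ (f s)) refl

    inv-to : ∀ s b → inv s (Bijection.to (f s) b) ≡ b
    inv-to s b = Inverse.inverseʳ (⤖⇒↔ (f s)) refl

  abstract
    -- Junk value 0 for balls that are not present in s.
    pos : State → Label → ℕ
    pos s y with live? s y
    ... | yes l = bin f s (unlabel s y l)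
    ... | no  _ = 0

    -- Junk value a₁ for bins that do not exist in s.
    content : State → ℕ → Label
    content s β with β <? (#bins s)
    ... | yes l = label (inv s (fromℕ< l))
    ... | no  _ = insertA , 0

    pos-label : ∀ s (b : Ball s) → pos s (label b) ≡ bin f s b
    pos-label s b with live? s (label b)
    ... | yes l = cong (bin f s) (unlabel-label b l)
    ... | no ¬l = contradiction (live-label b) ¬l

    content-toℕ : ∀ s (β : Bin s) → content s (toℕ β) ≡ label (inv s β)
    content-toℕ s β with toℕ β <? (#bins s)
    ... | yes l = cong (label ∘ inv s) (fromℕ<-toℕ β l)
    ... | no ¬l = contradiction (toℕ<n β) ¬l

  pos-< : ∀ s y → Live s y → pos s y < #bins s
  pos-< s y l = subst (λ z → pos s z < #bins s) (label-unlabel s y l)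
    (subst (_< #bins s) (sym (pos-label s b)) (toℕ<n (Bijection.to (f s) b)))
    where b = unlabel s y l

  content-pos : ∀ s y → Live s y → content s (pos s y) ≡ y
  content-pos s y l = subst (λ z → content s (pos s z) ≡ z) (label-unlabel s y l)
    (trans (cong (content s) (pos-label s b))
      (trans (content-toℕ s (Bijection.to (f s) b)) (cong label (inv-to s b))))
    where b = unlabel s y l

  private
    at-toℕ : ∀ {s} (P : ℕ → Set) → (∀ (β : Bin s) → P (toℕ β)) → ∀ β → β < #bins s → P β
    at-toℕ P h β l = subst P (toℕ-fromℕ< l) (h (fromℕ< l))

  pos-content : ∀ s β → β < #bins s → pos s (content s β) ≡ β
  pos-content s = at-toℕ {s} (λ β → pos s (content s β) ≡ β) (λ β →
    trans (cong (pos s) (content-toℕ s β))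
      (trans (pos-label s (inv s β)) (cong toℕ (to-inv s β))))

  -- A placement is a bijection, so it only permutes the terms. Every exchange of a sum over balls
  -- for a sum over bins rests on this.
  ∑ᵇ-content : ∀ s F → ∑ᵇ s F ≡ ∑ (#bins s) (F ∘ content s)
  ∑ᵇ-content s@(p , q) F = begin
    ∑ᵇ s F                                      ≡⟨ ∑ᵇ-label p q F ⟩
    sumᶠ {p + q} (F ∘ label ∘ splitAt p)                ≡⟨ sum-cong-≗ {p + q}
      (λ i → cong (F ∘ label) (inv-to s (splitAt p i))) ⟨
    sumᶠ {p + q} (F ∘ label ∘ inv s ∘ Inverse.to π)     ≡⟨ sum-permute (F ∘ label ∘ inv s) π ⟨
    sumᶠ {p + q} (F ∘ label ∘ inv s)                    ≡⟨ sum-cong-≗ {p + q}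
      (λ β → cong F (content-toℕ s β)) ⟨
    sumᶠ {p + q} (F ∘ content s ∘ toℕ)                  ≡⟨ ∑≡sum (p + q) (F ∘ content s) ⟨
    ∑ (p + q) (F ∘ content s)                   ∎
    where
    open ≡-Reasoning
    π : Fin (p + q) ↔ Fin (p + q)
    π = ⤖⇒↔ (f s) ↔-∘ +↔⊎ {p} {q}

  ∑ᵇ-pos : ∀ s g → ∑ᵇ s (g ∘ pos s) ≡ ∑ (#bins s) g
  ∑ᵇ-pos s g = trans (∑ᵇ-content s (g ∘ pos s))
    (∑-cong (#bins s) (λ β l → cong g (pos-content s β l)))

  abstract
    live : State → Label → Bool
    live s (k , i) = i <ᵇ size s k

    live-true : ∀ s y → Live s y → live s y ≡ true
    live-true s (k , i) l = <⇒<ᵇ≡true l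

    live-false : ∀ s y → ¬ Live s y → live s y ≡ false
    live-false s (k , i) l = ≮⇒<ᵇ≡false l

    -- Presence in `s` is part of the test, so a ball absent from `s` counts as not kept, whatever
    -- the junk value of `pos`.
    kept : State → State → Label → Bool
    kept s t y = live s y ∧ (pos s y ≡ᵇ pos t y)

    kept-true : ∀ s t y → kept s t y ≡ true → Live s y × pos s y ≡ pos t y
    kept-true s t y@(k , i) e =
      <ᵇ-true i _ (∧-conicalˡ _ _ e) , ≡ᵇ-true _ _ (∧-conicalʳ (live s y) _ e)

    kept-live : ∀ s t y → Live s y → kept s t y ≡ (pos s y ≡ᵇ pos t y)
    kept-live s t y l = cong (_∧ (pos s y ≡ᵇ pos t y)) (live-true s y l)

  kept-≡ : ∀ s t y → Live s y → pos s y ≡ pos t y → kept s t y ≡ true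
  kept-≡ s t y l e = trans (kept-live s t y l) (trans (cong (_≡ᵇ pos t y) e) (≡ᵇ-refl (pos t y)))

  kept-false : ∀ s t y → ¬ (Live s y × pos s y ≡ pos t y) → kept s t y ≡ false
  kept-false s t y h with kept s t y in e
  ... | true  = contradiction (kept-true s t y e) h
  ... | false = refl

  -- Links the cost, which filters a list of balls, with sums over labels. An old ball keeps its
  -- label, so one label is compared in both states.
  cost-≥ : ∀ i s (F : Label → ℕ) → (∀ y → Live s y → F y ≤ ⟦ not (kept s (insert i s) y) ⟧) →
           ∑ᵇ s F ≤ cost f i s
  cost-≥ i s@(p , q) F h = begin
    ∑ᵇ s F
      ≤⟨ +-mono-≤ (∑-filter P? p inj₁ _ (h′ ∘ inj₁)) (∑-filter P? q inj₂ _ (h′ ∘ inj₂)) ⟩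
    length (filter P? (tabulate inj₁)) + length (filter P? (tabulate inj₂))
      ≡⟨ length-++ (filter P? (tabulate inj₁)) ⟨
    length (filter P? (tabulate inj₁) ++ filter P? (tabulate inj₂))
      ≡⟨ cong length (filter-++ P? (tabulate inj₁) (tabulate inj₂)) ⟨
    length (filter P? (tabulate inj₁ ++ tabulate inj₂))
      ≡⟨ cong (length ∘ filter P?) (cong₂ _++_ (map-tabulate id inj₁) (map-tabulate id inj₂)) ⟨
    cost f i s ∎
    where
    open ≤-Reasoning
    P? = λ b → ¬? (bin f (insert i s) (old i s b) ℕₚ.≟ bin f s b)
    h′ : ∀ b → F (label b) ≤ ⟦ does (P? b) ⟧
    h′ b = ≤-trans (h (label b) (live-label b)) (≤-reflexive (cong (⟦_⟧ ∘ not) eq))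
      where
      t = insert i s
      ≡ᵇ-sym : ∀ m n → (m ≡ᵇ n) ≡ (n ≡ᵇ m)
      ≡ᵇ-sym zero    zero    = refl
      ≡ᵇ-sym zero    (suc n) = refl
      ≡ᵇ-sym (suc m) zero    = refl
      ≡ᵇ-sym (suc m) (suc n) = ≡ᵇ-sym m n
      eq : kept s t (label b) ≡ (bin f t (old i s b) ≡ᵇ bin f s b)
      eq = trans (trans (kept-live s t (label b) (live-label b)) (cong₂ _≡ᵇ_ (pos-label s b)
             (trans (cong (pos t) (sym (label-old i s b))) (pos-label t (old i s b)))))
           (≡ᵇ-sym (bin f s b) (bin f t (old i s b)))

-- Agreement of times of change

⟦⟧≤1 : ∀ b → ⟦ b ⟧ ≤ 1
⟦⟧≤1 false = z≤n
⟦⟧≤1 true  = ≤-refl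

agree differ : ℕ → ℕ → ℕ
agree  m n = ⟦ m ≡ᵇ n ⟧
differ m n = ⟦ not (m ≡ᵇ n) ⟧

agree-refl : ∀ m → agree m m ≡ 1
agree-refl m = cong ⟦_⟧ (≡ᵇ-refl m)

agree-≢ : ∀ m n → m ≢ n → agree m n ≡ 0
agree-≢ m n m≢n = cong ⟦_⟧ (≡ᵇ-≢ m n m≢n)

-- Agreement can change between the pairs `a`, `b` and `c`, `d` only if one component changes.
-- Below, `a` and `b` are last changes in two runs, `c` and `d` first changes; this direction serves
-- the bins, the next one the balls.
agree-differ : ∀ a b c d → agree c d ≤ agree a b + (differ a c + differ b d)
agree-differ a b c d with a ≡ᵇ c in e | b ≡ᵇ d in e′
... | false | _     = ≤-trans (⟦⟧≤1 (c ≡ᵇ d)) (≤-trans (m≤m+n 1 _) (m≤n+m _ (agree a b)))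
... | true  | false = ≤-trans (⟦⟧≤1 (c ≡ᵇ d)) (m≤n+m 1 (agree a b))
... | true  | true
  rewrite ≡ᵇ-true a c e | ≡ᵇ-true b d e′ = m≤m+n (agree c d) 0

agree-differ′ : ∀ a b c d → agree a b ≤ agree c d + (differ a c + differ b d)
agree-differ′ a b c d with a ≡ᵇ c in e | b ≡ᵇ d in e′
... | false | _     = ≤-trans (⟦⟧≤1 (a ≡ᵇ b)) (≤-trans (m≤m+n 1 _) (m≤n+m _ (agree c d)))
... | true  | false = ≤-trans (⟦⟧≤1 (a ≡ᵇ b)) (m≤n+m 1 (agree c d))
... | true  | true
  rewrite ≡ᵇ-true a c e | ≡ᵇ-true b d e′ = m≤m+n (agree c d) 0

-- The time of first change after a round: n if the item was created in
-- this round, otherwise the earlier first change, if any; 0 means never.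
first : (existed unchanged : Bool) → ℕ → ℕ → ℕ
first false k     n t       = n
first true  k     n (suc t) = suc t
first true  true  n zero    = zero
first true  false n zero    = n

-- Here `l` is the last and `t` the first change before the round, and `k` says that the round
-- changes nothing. A first change sets both to `suc n`. A later one can make them differ only if
-- `l` is positive, which the last term charges; for `l = 0` and positive `t` they differ already.
differ-step : ∀ k n l t →
  differ (if k then l else suc n) (first true k (suc n) t)
    ≤ differ l t + ⟦ (0 <ᵇ l) ∧ not k ⟧
differ-step true  n l       zero    = m≤m+n _ _
differ-step true  n l       (suc t) = m≤m+n _ _
differ-step false n l       zero    rewrite ≡ᵇ-refl n = z≤n
differ-step false n zero    (suc t) = ⟦⟧≤1 (not (n ≡ᵇ t))
differ-step false n (suc l) (suc t) = ≤-trans (⟦⟧≤1 (not (n ≡ᵇ t))) (m≤n+m 1 _)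

-- Crossings in a single run

module Crossing (f : Placement) where
  open Layout f public

  relocated : (Label → Bool) → State → State → ℕ
  relocated T s t = ∑ᵇ s (λ y → ⟦ T y ∧ not (kept s t y) ⟧)

  module Run (st : ℕ → State) (st-mono : ∀ j → st j ⊑ st (suc j)) where

    ⊑-+ : ∀ j d → st j ⊑ st (d + j)
    ⊑-+ j zero    = ⊑-refl
    ⊑-+ j (suc d) = ⊑-trans (⊑-+ j d) (st-mono (d + j))

    ⊑-≤ : ∀ {i j} → i ≤ j → st i ⊑ st j
    ⊑-≤ {i} {j} i≤j = subst (λ k → st i ⊑ st k) (m∸n+n≡m i≤j) (⊑-+ i (j ∸ i))

    still : ℕ → Label → Bool
    still j = kept (st j) (st (suc j))

    -- Rounds are numbered from 1, and 0 means never. Arrival counts as a move, since `kept` fails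
    -- for absent balls.
    lastMove : ℕ → Label → ℕ
    lastMove zero    y = 0
    lastMove (suc j) y = if still j y then lastMove j y else suc j

    firstMove : ℕ → Label → ℕ
    firstMove zero    y = 0
    firstMove (suc j) y = first (live (st j) y) (still j y) (suc j) (firstMove j y)

    firstChange : ℕ → ℕ → ℕ
    firstChange zero    β = 0
    firstChange (suc j) β =
      first (β <ᵇ (#bins (st j))) (still j (content (st j) β)) (suc j) (firstChange j β)

    -- Each round contributes the balls that arrived or moved in an earlier round and have different
    -- bins at its two ends; a ball that leaves and returns within the round is not counted.
    crossings : ℕ → ℕ
    crossings zero    = 0
    crossings (suc j) = crossings j + relocated (λ y → 0 <ᵇ lastMove j y) (st j) (st (suc j))

    -- Two different stamps require a move after an earlier one, in another round, and that is a
    -- crossing. A ball arriving in the current round gets the same stamp twice.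
    moved-twice : ∀ j → ∑ᵇ (st j) (λ y → differ (lastMove j y) (firstMove j y)) ≤ crossings j
    moved-twice zero    = ∑ᵇ-vanish {t = st 0} _ (λ { insertA → z≤n ; insertB → z≤n }) (λ _ _ _ → refl)
    moved-twice (suc j) = begin
      ∑ᵇ (st (suc j)) F′     ≤⟨ ∑ᵇ-vanish F′ (st-mono j) new ⟩
      ∑ᵇ (st j) F′           ≤⟨ ∑ᵇ-mono (st j) old-balls ⟩
      ∑ᵇ (st j) (λ y → F y + G y) ≡⟨ ∑ᵇ-+ (st j) F G ⟩
      ∑ᵇ (st j) F + ∑ᵇ (st j) G ≤⟨ +-monoˡ-≤ _ (moved-twice j) ⟩
      crossings (suc j) ∎
      where
      open ≤-Reasoning
      F′ F G : Label → ℕ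
      F′ y = differ (lastMove (suc j) y) (firstMove (suc j) y)
      F  y = differ (lastMove j y) (firstMove j y)
      G  y = ⟦ (0 <ᵇ lastMove j y) ∧ not (still j y) ⟧
      new : ∀ y → ¬ Live (st j) y → Live (st (suc j)) y → F′ y ≡ 0
      new y ¬l l rewrite live-false (st j) y ¬l
        | kept-false (st j) (st (suc j)) y (¬l ∘ proj₁) | ≡ᵇ-refl j = refl
      old-balls : ∀ y → Live (st j) y → F′ y ≤ F y + G y
      old-balls y l rewrite live-true (st j) y l =
        differ-step (still j y) j (lastMove j y) (firstMove j y)

    -- If the occupant of a bin leaves, the next occupant was elsewhere or absent at the start of
    -- the round, so it moves in this round too. Hence the last move of the occupant is also the
    -- last change of the bin.
    lastMove-content : ∀ j β → β < #bins (st j) → let z = content (st j) β in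
      lastMove (suc j) (content (st (suc j)) β) ≡ (if still j z then lastMove j z else suc j)
    lastMove-content j β l with still j (content (st j) β) in e
    ... | true  = trans (cong (lastMove (suc j)) same) (cong (λ b → if b then lastMove j z else suc j) e)
      where
      z = content (st j) β
      z-kept = kept-true (st j) (st (suc j)) z e
      same : content (st (suc j)) β ≡ z
      same = trans (cong (content (st (suc j))) (trans (sym (pos-content (st j) β l)) (proj₂ z-kept)))
               (content-pos (st (suc j)) z (Live-⊑ (st-mono j) z (proj₁ z-kept)))
    ... | false = cong (λ b → if b then lastMove j z′ else suc j)
                    (kept-false (st j) (st (suc j)) z′ (λ { (lz , eq) → absurd lz eq }))
      where
      z z′ : Label
      z  = content (st j) β
      z′ = content (st (suc j)) β
      absurd : Live (st j) z′ → ¬ pos (st j) z′ ≡ pos (st (suc j)) z′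
      absurd lz eq with trans (sym e) (subst (λ w → still j w ≡ true) z′≡z (kept-≡ (st j) (st (suc j)) z′ lz eq))
        where
        z′≡z : z′ ≡ z
        z′≡z = trans (sym (content-pos (st j) z′ lz)) (cong (content (st j))
          (trans eq (pos-content (st (suc j)) β (≤-trans l (⊑-size (st-mono j))))))
      ... | ()

    lastMove-new-bin : ∀ j β → #bins (st j) ≤ β → β < (#bins (st (suc j))) →
      lastMove (suc j) (content (st (suc j)) β) ≡ suc j
    lastMove-new-bin j β g l = cong (λ b → if b then lastMove j z′ else suc j)
      (kept-false (st j) (st (suc j)) z′ (λ { (lz , eq) → <⇒≱
        (subst (_< #bins (st j)) (trans eq (pos-content (st (suc j)) β l)) (pos-< (st j) z′ lz)) g }))
      where z′ = content (st (suc j)) β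

    -- The induction of `moved-twice`, carried out over bins: a repeated change is charged to the
    -- occupant at the start of the round, and `∑ᵇ-content` turns these charges into crossings.
    changed-twice : ∀ j → ∑ (#bins (st j)) (λ β → differ (lastMove j (content (st j) β)) (firstChange j β))
                          ≤ crossings j
    changed-twice zero    = ∑-vanish {n = (#bins (st 0))} _ z≤n (λ _ _ _ → refl)
    changed-twice (suc j) = begin
      ∑ (#bins (st (suc j))) F′    ≤⟨ ∑-vanish F′ (⊑-size (st-mono j)) new ⟩
      ∑ (#bins (st j)) F′          ≤⟨ ∑-mono (#bins (st j)) old-bins ⟩
      ∑ (#bins (st j)) (λ β → F β + G (content (st j) β)) ≡⟨ ∑-+ (#bins (st j)) F _ ⟩
      ∑ (#bins (st j)) F + ∑ (#bins (st j)) (G ∘ content (st j))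
        ≤⟨ +-mono-≤ (changed-twice j) (≤-reflexive (sym (∑ᵇ-content (st j) G))) ⟩
      crossings (suc j) ∎
      where
      open ≤-Reasoning
      F′ F : ℕ → ℕ
      F′ β = differ (lastMove (suc j) (content (st (suc j)) β)) (firstChange (suc j) β)
      F  β = differ (lastMove j (content (st j) β)) (firstChange j β)
      G : Label → ℕ
      G y = ⟦ (0 <ᵇ lastMove j y) ∧ not (still j y) ⟧
      new : ∀ β → #bins (st j) ≤ β → β < (#bins (st (suc j))) → F′ β ≡ 0
      new β g l rewrite lastMove-new-bin j β g l | ≮⇒<ᵇ≡false (≤⇒≯ g) | ≡ᵇ-refl j = refl
      old-bins : ∀ β → β < #bins (st j) → F′ β ≤ F β + G (content (st j) β)
      old-bins β l rewrite lastMove-content j β l | <⇒<ᵇ≡true l =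
        differ-step (still j z) j (lastMove j z) (firstChange j β)
        where z = content (st j) β

    -- An old ball stays in its initial bin until it first moves, and this is the first change of
    -- that bin. The second component carries the induction while no move has happened.
    first-home : ∀ j v → Live (st 0) v →
      firstMove j v ≡ firstChange j (pos (st 0) v)
        × (firstMove j v ≡ 0 → pos (st j) v ≡ pos (st 0) v)
    first-home zero    v l = refl , λ _ → refl
    first-home (suc j) v l
      rewrite live-true (st j) v (Live-⊑ (⊑-≤ z≤n) v l)
            | <⇒<ᵇ≡true (≤-trans (pos-< (st 0) v l) (⊑-size (⊑-≤ {0} {j} z≤n)))
            with firstMove j v | firstChange j (pos (st 0) v) | first-home j v l
    ... | suc t | .(suc t) | refl , _ = refl , λ ()
    ... | zero  | .zero    | refl , h
      rewrite trans (cong (content (st j)) (sym (h refl))) (content-pos (st j) v (Live-⊑ (⊑-≤ z≤n) v l))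
      with still j v in e
    ... | true  = refl , λ _ → trans (sym (proj₂ (kept-true (st j) (st (suc j)) v e))) (h refl)
    ... | false = refl , λ ()

    firstMove-> : ∀ j d y → ¬ Live (st j) y → j < firstMove (suc d + j) y
    firstMove-> j zero    y ¬l rewrite live-false (st j) y ¬l = ≤-refl
    firstMove-> j (suc d) y ¬l with live (st (suc d + j)) y
    ... | false = s≤s (m≤n+m j (suc d))
    ... | true  with firstMove (suc d + j) y | firstMove-> j d y ¬l
    ...   | suc t | h = h

    firstMove-≤ : ∀ j y → firstMove j y ≤ j
    firstMove-≤ zero    y = z≤n
    firstMove-≤ (suc j) y with live (st j) y | still j y | firstMove j y | firstMove-≤ j y
    ... | false | _     | _     | _ = ≤-refl
    ... | true  | true  | zero  | _ = z≤n
    ... | true  | false | zero  | _ = ≤-refl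
    ... | true  | _     | suc t | h = m≤n⇒m≤1+n h

    firstMove-new-≤ : ∀ j d y → ¬ Live (st 0) y → Live (st j) y → firstMove (d + j) y ≤ j
    firstMove-new-≤ zero    d       y ¬l l = contradiction l ¬l
    firstMove-new-≤ (suc j) zero    y ¬l l = firstMove-≤ (suc j) y
    firstMove-new-≤ (suc j) (suc d) y ¬l l
      rewrite live-true (st (d + suc j)) y (Live-⊑ (⊑-+ (suc j) d) y l)
      with firstMove (d + suc j) y | firstMove-new-≤ (suc j) d y ¬l l
         -- A ball absent at the start has a positive stamp, which excludes the case `zero`.
         | subst (λ m → 0 < firstMove m y) (trans (cong suc (+-identityʳ (d + j))) (sym (+-suc d j)))
             (firstMove-> 0 (d + j) y ¬l)
    ... | suc t | h | _ = h

  -- Double counting for two runs with common ends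

  module TwoRuns
    (st st′ : ℕ → State) (st-mono : ∀ j → st j ⊑ st (suc j)) (st′-mono : ∀ j → st′ j ⊑ st′ (suc j))
    (n : ℕ) (start : st 0 ≡ st′ 0) (end : st n ≡ st′ n) (sizes : ∀ j → #bins (st j) ≡ #bins (st′ j))
    where

    private
      module R = Run st st-mono
      module R′ = Run st′ st′-mono

    -- The creation round of a bin depends only on the numbers of bins, which agree by `sizes`; the
    -- positive stamp is not overwritten later.
    firstChange-new : ∀ j β → #bins (st 0) ≤ β → β < #bins (st j) → R.firstChange j β ≡ R′.firstChange j β
      × (0 < R.firstChange j β)
    firstChange-new zero    β g l = contradiction g (<⇒≱ l)
    firstChange-new (suc j) β g l rewrite sym (sizes j) with β <ᵇ (#bins (st j)) in e
    ... | false = refl , s≤s z≤n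
    ... | true  with R.firstChange j β | R′.firstChange j β | firstChange-new j β g (<ᵇ-true β _ e)
    ...   | suc t | .(suc t) | refl , _ = refl , s≤s z≤n

    sameBirth : Label → ℕ
    sameBirth y = agree (R.firstMove n y) (R′.firstMove n y)

    private
      X = R.crossings n + R′.crossings n

      χ : Label → ℕ
      χ y = agree (R.lastMove n y) (R′.lastMove n y)

      θ : ℕ → ℕ
      θ β = agree (R.firstChange n β) (R′.firstChange n β)

      s t : State
      s = st 0
      t = st n

      s⊑t : s ⊑ t
      s⊑t = R.⊑-≤ z≤n

      bins : ∑ (#bins t) θ ≤ ∑ᵇ t χ + X
      bins = begin
        ∑ (#bins t) θ ≤⟨ ∑-mono (#bins t) (λ β _ → agree-differ (R.lastMove n (c β)) (R′.lastMove n (c β)) _ _) ⟩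
        ∑ (#bins t) (λ β → χ (c β) + (D β + D′ β)) ≡⟨ ∑-+ (#bins t) (χ ∘ c) _ ⟩
        ∑ (#bins t) (χ ∘ c) + ∑ (#bins t) (λ β → D β + D′ β)
          ≡⟨ cong₂ _+_ (sym (∑ᵇ-content t χ)) (∑-+ (#bins t) D D′) ⟩
        ∑ᵇ t χ + (∑ (#bins t) D + ∑ (#bins t) D′)
          -- The runs end in the same state, so each bin has the same final content in both.
          ≤⟨ +-monoʳ-≤ (∑ᵇ t χ) (+-mono-≤ (R.changed-twice n)
             (subst (λ u → ∑ (#bins u) (λ β → differ (R′.lastMove n (content u β)) (R′.firstChange n β)) ≤ R′.crossings n)
               (sym end) (R′.changed-twice n))) ⟩
        ∑ᵇ t χ + X ∎
        where
        open ≤-Reasoning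
        c = content t
        D D′ : ℕ → ℕ
        D  β = differ (R.lastMove n (c β)) (R.firstChange n β)
        D′ β = differ (R′.lastMove n (c β)) (R′.firstChange n β)

      balls-≤ : ∑ᵇ t χ ≤ ∑ᵇ t sameBirth + X
      balls-≤ = begin
        ∑ᵇ t χ ≤⟨ ∑ᵇ-mono t (λ y _ → agree-differ′ (R.lastMove n y) (R′.lastMove n y) (R.firstMove n y) (R′.firstMove n y)) ⟩
        ∑ᵇ t (λ y → sameBirth y + (D y + D′ y)) ≡⟨ ∑ᵇ-+ t sameBirth (λ y → D y + D′ y) ⟩
        ∑ᵇ t sameBirth + ∑ᵇ t (λ y → D y + D′ y) ≡⟨ cong (∑ᵇ t sameBirth +_) (∑ᵇ-+ t D D′) ⟩
        ∑ᵇ t sameBirth + (∑ᵇ t D + ∑ᵇ t D′)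
          ≤⟨ +-monoʳ-≤ (∑ᵇ t sameBirth) (+-mono-≤ (R.moved-twice n)
             (subst (λ u → ∑ᵇ u D′ ≤ R′.crossings n) (sym end) (R′.moved-twice n))) ⟩
        ∑ᵇ t sameBirth + X ∎
        where
        open ≤-Reasoning
        D D′ : Label → ℕ
        D  y = differ (R.lastMove n y) (R.firstMove n y)
        D′ y = differ (R′.lastMove n y) (R′.firstMove n y)

      home : ∑ (#bins s) θ ≡ ∑ᵇ s sameBirth
      home = trans (sym (∑ᵇ-pos s θ)) (∑ᵇ-cong s (λ y l → sym (cong₂ agree
        (proj₁ (R.first-home n y l))
        (trans (proj₁ (R′.first-home n y (subst (λ u → Live u y) start l)))
               (cong (λ u → R′.firstChange n (pos u y)) (sym start))))))

      new-bins : ∑ (#bins t) θ + #bins s ≡ ∑ (#bins s) θ + #bins t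
      new-bins = begin
        ∑ (#bins t) θ + a                      ≡⟨ cong (λ m → ∑ m θ + a) (sym eq) ⟩
        ∑ (a + d) θ + a                    ≡⟨ cong (_+ a) (∑-split a d θ) ⟩
        ∑ a θ + ∑ d (λ i → θ (a + i)) + a  ≡⟨ cong (λ m → ∑ a θ + m + a) (trans (∑-cong d one) (∑-const d 1)) ⟩
        ∑ a θ + d * 1 + a                  ≡⟨ cong (λ m → ∑ a θ + m + a) (*-identityʳ d) ⟩
        ∑ a θ + d + a                      ≡⟨ trans (+-assoc (∑ a θ) d a) (cong (∑ a θ +_) (trans (+-comm d a) eq)) ⟩
        ∑ a θ + #bins t ∎
        where
        open ≡-Reasoning
        a = (#bins s)
        d = (#bins t) ∸ (#bins s)
        eq : a + d ≡ #bins t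
        eq = m+[n∸m]≡n (⊑-size s⊑t)
        one : ∀ i → i < d → θ (a + i) ≡ 1
        one i l = trans (cong (agree (R.firstChange n (a + i))) (sym (proj₁
          (firstChange-new n (a + i) (m≤m+n a i) (subst (a + i <_) eq (+-monoʳ-< a l))))))
          (agree-refl (R.firstChange n (a + i)))

    -- Every ball of the final state and its final bin have the same last
    -- change; the first change is known, up to crossings, both from the
    -- ball and from the bin. Summing over the balls and over the bins
    -- cancels the contribution of the old balls and their initial bins.
    crossings-≥ : ∑ᵇ (st 0) sameBirth + #bins (st n)
      ≤ ∑ᵇ (st n) sameBirth + #bins (st 0) + 2 * (R.crossings n + R′.crossings n)
    crossings-≥ = begin
      ∑ᵇ s sameBirth + (#bins t)  ≡⟨ cong (_+ #bins t) home ⟨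
      ∑ (#bins s) θ + (#bins t)       ≡⟨ new-bins ⟨
      ∑ (#bins t) θ + (#bins s)       ≤⟨ +-monoˡ-≤ (#bins s) (≤-trans bins (+-monoˡ-≤ X balls-≤)) ⟩
      ∑ᵇ t sameBirth + X + X + #bins s ≡⟨ rearrange (∑ᵇ t sameBirth) X (#bins s) ⟩
      ∑ᵇ t sameBirth + #bins s + 2 * X ∎
      where
      open ≤-Reasoning
      open +-*-Solver
      rearrange : ∀ a b c → a + b + b + c ≡ a + c + 2 * b
      rearrange = solve 3 (λ a b c → a :+ b :+ b :+ c := a :+ c :+ con 2 :* b) refl

-- Words of insertions and the states they reach

run : State → List Insertion → State
run s []       = s
run s (i ∷ is) = run (insert i s) is

run-++ : ∀ s u v → run s (u ++ v) ≡ run (run s u) v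
run-++ s []      v = refl
run-++ s (i ∷ u) v = run-++ (insert i s) u v

⊑-run : ∀ s w → s ⊑ run s w
⊑-run s []      = ⊑-refl
⊑-run s (i ∷ w) = ⊑-trans (⊑-insert i s) (⊑-run (insert i s) w)

concat< : (ℕ → List Insertion) → ℕ → List Insertion
concat< W zero    = []
concat< W (suc n) = concat< W n ++ W n

-- Crossings forced by separated rounds

module Separation (f : Placement)
    (st st′ : ℕ → State) (st-mono : ∀ j → st j ⊑ st (suc j)) (st′-mono : ∀ j → st′ j ⊑ st′ (suc j))
    (n : ℕ) (start : st 0 ≡ st′ 0) (end : st n ≡ st′ n) (sizes : ∀ j → #bins (st j) ≡ #bins (st′ j))
    where

    open Crossing f
    open TwoRuns st st′ st-mono st′-mono n start end sizes
    private
      module R  = Run st st-mono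
      module R′ = Run st′ st′-mono

    -- In round j the balls a_i arriving in the first run have not yet
    -- arrived in the second run, and the balls b_i have arrived before.
    Separated : ℕ → Set
    Separated j = size (st′ (suc j)) insertA ≤ size (st j) insertA
                × size (st (suc j)) insertB ≤ size (st′ j) insertB

    -- In the second run the ball arrives after round `j` if it is an a, and before round `j` if it
    -- is a b.
    sameBirth≡0 : ∀ j → j < n → Separated j →
      ∀ y → ¬ Live (st j) y → Live (st (suc j)) y → sameBirth y ≡ 0
    sameBirth≡0 j j<n (sepA , sepB) y ¬l l = agree-≢ _ _ (differ-birth y ¬l l)
      where
      dead₀ : ∀ y → ¬ Live (st j) y → ¬ Live (st 0) y
      dead₀ y ¬l = ¬l ∘ Live-⊑ (R.⊑-≤ z≤n) y
      eqn : n ∸ suc j + suc j ≡ n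
      eqn = m∸n+n≡m j<n
      born : ∀ y → ¬ Live (st j) y → j < R.firstMove n y
      born y ¬l = subst (λ m → j < R.firstMove m y) (trans (sym (+-suc _ j)) eqn)
        (R.firstMove-> j (n ∸ suc j) y ¬l)
      by : ∀ y → ¬ Live (st j) y → Live (st (suc j)) y → R.firstMove n y ≤ suc j
      by y ¬l l = subst (λ m → R.firstMove m y ≤ suc j) eqn
        (R.firstMove-new-≤ (suc j) (n ∸ suc j) y (dead₀ y ¬l) l)
      differ-birth : ∀ y → ¬ Live (st j) y → Live (st (suc j)) y → R.firstMove n y ≢ R′.firstMove n y
      differ-birth y@(insertA , i) ¬l l eq with m≤n⇒m<n∨m≡n j<n
      -- If `j` is the last round, the common final state and the separation would put the ball into
      -- `st j` already.
      ... | inj₂ refl = ¬l (≤-trans (subst (λ u → i < size u insertA) end l) sepA)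
      ... | inj₁ sj<n = <⇒≱ late (subst (_≤ suc j) eq (by y ¬l l))
        where
        late : suc j < R′.firstMove n y
        late = subst (λ m → suc j < R′.firstMove m y) (trans (sym (+-suc _ (suc j))) (m∸n+n≡m sj<n))
          (R′.firstMove-> (suc j) (n ∸ suc (suc j)) y (λ l′ → ¬l (≤-trans l′ sepA)))
      differ-birth y@(insertB , i) ¬l l eq = <⇒≱ (born y ¬l) (subst (_≤ j) (sym eq) early)
        where
        early : R′.firstMove n y ≤ j
        early = subst (λ m → R′.firstMove m y ≤ j) (m∸n+n≡m (<⇒≤ j<n))
          (R′.firstMove-new-≤ j (n ∸ j) y (λ l₀ → dead₀ y ¬l (subst (λ u → Live u y) (sym start) l₀))
            (≤-trans l sepB))

    sameBirth-separated : ∀ j d → d + j ≤ n → (∀ i → j ≤ i → i < d + j → Separated i) →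
      ∑ᵇ (st (d + j)) sameBirth ≤ ∑ᵇ (st j) sameBirth
    sameBirth-separated j zero    le sep = ≤-refl
    sameBirth-separated j (suc d) le sep = ≤-trans
      (∑ᵇ-vanish sameBirth (st-mono (d + j)) (sameBirth≡0 (d + j) le (sep (d + j) (m≤n+m j d) ≤-refl)))
      (sameBirth-separated j d (≤-trans (n≤1+n _) le) (λ i a b → sep i a (m≤n⇒m≤1+n b)))

    -- Balls arriving before or after the separated rounds contribute at most 1 each to the sum of
    -- `sameBirth`, those arriving within them nothing. By `crossings-≥` this deficit is at most
    -- twice the crossings. Common summands are added to both sides to avoid subtraction.
    crossings-separated : ∀ a d → d + a ≤ n → (∀ i → a ≤ i → i < d + a → Separated i) →
      #bins (st (d + a)) ≤ #bins (st a) + 2 * (R.crossings n + R′.crossings n)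
    crossings-separated a d b≤n sep = +-cancelˡ-≤ (K 0 + E + (K n + C + A)) _ _ (begin
      (K 0 + E + (K n + C + A)) + B
        ≡⟨ solve 6 (λ k₀ e kn c a b → (k₀ :+ e :+ (kn :+ c :+ a)) :+ b
             := (k₀ :+ e) :+ ((kn :+ b) :+ (a :+ c))) refl (K 0) E (K n) C A B ⟩
      (K 0 + E) + ((K n + B) + (A + C))
        ≤⟨ +-mono-≤ crossings-≥ (+-mono-≤ (bounded b≤n) (bounded {0} {a} z≤n)) ⟩
      (K n + C + 2 * X) + ((K b + E) + (K 0 + D))
        ≤⟨ +-monoʳ-≤ (K n + C + 2 * X) (+-monoˡ-≤ (K 0 + D) (+-monoˡ-≤ E (sameBirth-separated a d b≤n sep))) ⟩
      (K n + C + 2 * X) + ((A + E) + (K 0 + D))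
        ≡⟨ solve 7 (λ k₀ e kn c a d x → (kn :+ c :+ x) :+ ((a :+ e) :+ (k₀ :+ d))
             := (k₀ :+ e :+ (kn :+ c :+ a)) :+ (d :+ x)) refl (K 0) E (K n) C A D (2 * X) ⟩
      (K 0 + E + (K n + C + A)) + (D + 2 * X) ∎)
      where
      open ≤-Reasoning
      open +-*-Solver
      b = d + a
      K : ℕ → ℕ
      K j = ∑ᵇ (st j) sameBirth
      X = R.crossings n + R′.crossings n
      A = K a
      B = #bins (st b)
      C = #bins (st 0)
      D = #bins (st a)
      E = #bins (st n)
      bounded : ∀ {i j} → i ≤ j → K j + #bins (st i) ≤ K i + #bins (st j)
      bounded le = ∑ᵇ-bounded sameBirth (λ y → ⟦⟧≤1 (R.firstMove n y ≡ᵇ R′.firstMove n y)) (R.⊑-≤ le)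

-- Charging relocations to rounds

module Touching (f : Placement) where
  open Crossing f

  -- As `kept` fails for absent labels, every ball still to come is marked as well; `relocated` sums
  -- over live balls, so none is charged before its arrival.
  touch : State → State → (Label → Bool) → Label → Bool
  touch s t T y = T y ∨ not (kept s t y)

  touched : (Label → Bool) → State → List Insertion → Label → Bool
  touched T s []       = T
  touched T s (i ∷ is) = touched (touch s (insert i s) T) (insert i s) is

  -- Only balls that are marked by T, new, or already relocated along the
  -- word are charged; so the first relocation in a round of a ball touched
  -- in an earlier round is charged to the rounds together, not to its own.
  recost : (Label → Bool) → State → List Insertion → ℕ
  recost T s []       = 0
  recost T s (i ∷ is) = relocated T s t + recost (touch s t T) t is
    where t = insert i s

  none : Label → Bool
  none _ = false

  relocated-≤ : ∀ {T U : Label → Bool} s t → (∀ y → Live s y → T y ≡ true → U y ≡ true) →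
    relocated T s t ≤ relocated U s t
  relocated-≤ {T} {U} s t h = ∑ᵇ-mono s aux
    where
    aux : ∀ y → Live s y → ⟦ T y ∧ not (kept s t y) ⟧ ≤ ⟦ U y ∧ not (kept s t y) ⟧
    aux y l with T y in e
    ... | false = z≤n
    ... | true rewrite h y l e = ≤-refl

  recost-≤-costFrom : ∀ T s w → recost T s w ≤ costFrom f s w
  recost-≤-costFrom T s []       = z≤n
  recost-≤-costFrom T s (i ∷ is) = +-mono-≤ (cost-≥ i s _ (λ y _ → aux (T y) _))
    (recost-≤-costFrom _ (insert i s) is)
    where
    aux : ∀ a b → ⟦ a ∧ b ⟧ ≤ ⟦ b ⟧
    aux false b = z≤n
    aux true  b = ≤-refl

  recost-++ : ∀ T s u v → recost T s (u ++ v) ≡ recost T s u + recost (touched T s u) (run s u) v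
  recost-++ T s []      v = refl
  recost-++ T s (i ∷ u) v = trans (cong (relocated T s t +_) (recost-++ (touch s t T) t u v))
    (sym (+-assoc (relocated T s t) _ _))
    where t = insert i s

  touched-++ : ∀ T s u v → touched T s (u ++ v) ≡ touched (touched T s u) (run s u) v
  touched-++ T s []      v = refl
  touched-++ T s (i ∷ u) v = touched-++ (touch s (insert i s) T) (insert i s) u v

  touched-⊇ : ∀ T s w y → T y ≡ true → touched T s w y ≡ true
  touched-⊇ T s []      y e = e
  touched-⊇ T s (i ∷ w) y e = touched-⊇ _ (insert i s) w y (cong (_∨ not (kept s (insert i s) y)) e)

  -- If every insertion kept `y`, its bin would be the same at both ends; so some insertion moved
  -- it, or it arrived on the way.
  ¬kept⇒touched : ∀ T s w y → Live (run s w) y → kept s (run s w) y ≡ false → touched T s w y ≡ true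
  ¬kept⇒touched T s []      y l e = contradiction (trans (sym e) (kept-≡ s s y l refl)) λ ()
  ¬kept⇒touched T s (i ∷ w) y l e with kept s (insert i s) y in e₁
  ... | false = touched-⊇ (touch s t T) t w y (trans (cong (λ b → T y ∨ not b) e₁) (∨-zeroʳ (T y)))
    where
    t = insert i s
  ... | true  = ¬kept⇒touched (touch s t T) t w y l (kept-false t (run t w) y λ (_ , eq) →
    contradiction (trans (sym e) (kept-≡ s (run t w) y ls (trans eq₁ eq))) λ ())
    where
    t = insert i s
    ls = proj₁ (kept-true s t y e₁)
    eq₁ = proj₂ (kept-true s t y e₁)

  -- A ball in `T` but not in `U` that ends in another bin is relocated at least once. Its first
  -- relocation is charged under `T` only; from then on both sets contain it.
  recost-split : ∀ T U s w → (∀ y → U y ≡ true → T y ≡ true) →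
    recost U s w + ∑ᵇ s (λ y → ⟦ (T y ∧ not (U y)) ∧ not (kept s (run s w) y) ⟧) ≤ recost T s w
  recost-split T U s []      U⊆T = ≤-trans (∑ᵇ-mono s aux)
      (∑ᵇ-vanish {0 , 0} {s} (λ _ → 0) (λ { insertA → z≤n ; insertB → z≤n }) (λ _ _ _ → refl))
    where
    aux : ∀ y → Live s y → ⟦ (T y ∧ not (U y)) ∧ not (kept s s y) ⟧ ≤ 0
    aux y l rewrite kept-≡ s s y l refl with T y ∧ not (U y)
    ... | false = z≤n
    ... | true  = z≤n
  recost-split T U s (i ∷ w) U⊆T = begin
    (relocated U s t + recost U′ t w) + ∑ᵇ s G
      ≤⟨ +-monoʳ-≤ (relocated U s t + recost U′ t w) (≤-trans (∑ᵇ-mono s pointwise)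
         (≤-trans (≤-reflexive (∑ᵇ-+ s G₁ G₂)) (+-monoʳ-≤ (∑ᵇ s G₁) (∑ᵇ-⊑ G₂ (⊑-insert i s))))) ⟩
    (relocated U s t + recost U′ t w) + (∑ᵇ s G₁ + ∑ᵇ t G₂)
      ≡⟨ interchange (relocated U s t) (recost U′ t w) (∑ᵇ s G₁) (∑ᵇ t G₂) ⟩
    (relocated U s t + ∑ᵇ s G₁) + (recost U′ t w + ∑ᵇ t G₂)
      ≤⟨ +-mono-≤ (≤-trans (≤-reflexive (sym (∑ᵇ-+ s G₀ G₁))) (∑ᵇ-mono s (λ y _ → now y)))
           (recost-split T′ U′ t w later) ⟩
    relocated T s t + recost T′ t w ∎
    where
    open ≤-Reasoning
    t = insert i s
    T′ = touch s t T
    U′ = touch s t U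
    G G₀ G₁ G₂ : Label → ℕ
    G₀ y = ⟦ U y ∧ not (kept s t y) ⟧
    G  y = ⟦ (T y ∧ not (U y)) ∧ not (kept s (run t w) y) ⟧
    G₁ y = ⟦ (T y ∧ not (U y)) ∧ not (kept s t y) ⟧
    G₂ y = ⟦ (T′ y ∧ not (U′ y)) ∧ not (kept t (run t w) y) ⟧
    now : ∀ y → G₀ y + G₁ y ≤ ⟦ T y ∧ not (kept s t y) ⟧
    now y with T y | U y | U⊆T y
    ... | false | true  | h = contradiction (h refl) λ ()
    ... | false | false | h = z≤n
    ... | true  | true  | h = ≤-reflexive (+-identityʳ _)
    ... | true  | false | h = ≤-refl
    later : ∀ y → U′ y ≡ true → T′ y ≡ true
    later y e with T y | U y | U⊆T y
    ... | true  | _     | h = refl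
    ... | false | true  | h = contradiction (h refl) λ ()
    ... | false | false | h = e
    pointwise : ∀ y → Live s y → G y ≤ G₁ y + G₂ y
    pointwise y l with kept s t y in e
    ... | false rewrite ∧-identityʳ (T y ∧ not (U y)) = ≤-trans (⟦∧⟧≤ (T y ∧ not (U y)) _) (m≤m+n _ _)
      where
      ⟦∧⟧≤ : ∀ a b → ⟦ a ∧ b ⟧ ≤ ⟦ a ⟧
      ⟦∧⟧≤ false b = z≤n
      ⟦∧⟧≤ true  b = ⟦⟧≤1 b
    -- This insertion leaves both marks of `y` unchanged, and the comparison with the end may start
    -- from `t` instead of `s`.
    ... | true  = ≤-trans (≤-reflexive (cong ⟦_⟧ (cong₂ (λ a b → a ∧ not b)
                    (cong₂ (λ a b → a ∧ not b) (sym (∨-identityʳ (T y))) (sym (∨-identityʳ (U y)))) same)))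
                  (m≤n+m _ _)
      where
      eq : pos s y ≡ pos t y
      eq = proj₂ (kept-true s t y e)
      same : kept s (run t w) y ≡ kept t (run t w) y
      same = trans (kept-live s (run t w) y l) (trans (cong (_≡ᵇ pos (run t w) y) eq)
        (sym (kept-live t (run t w) y (Live-⊑ (⊑-insert i s) y l))))

  recost-relocated : ∀ T s w → recost none s w + relocated T s (run s w) ≤ recost T s w
  recost-relocated T s w = ≤-trans (+-monoʳ-≤ (recost none s w) (∑ᵇ-mono s (λ y _ → aux (T y) (not (kept s (run s w) y)))))
    (recost-split T none s w (λ y ()))
    where
    aux : ∀ a b → ⟦ a ∧ b ⟧ ≤ ⟦ (a ∧ true) ∧ b ⟧
    aux false b = z≤n
    aux true  b = ≤-refl

  module Rounds (s : State) (W : ℕ → List Insertion) where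

    stage : ℕ → State
    stage j = run s (concat< W j)

    stage-suc : ∀ j → stage (suc j) ≡ run (stage j) (W j)
    stage-suc j = run-++ s (concat< W j) (W j)

    stage-mono : ∀ j → stage j ⊑ stage (suc j)
    stage-mono j = subst (stage j ⊑_) (sym (stage-suc j)) (⊑-run (stage j) (W j))

    open Run stage stage-mono

    lastMove⇒touched : ∀ j y → Live (stage j) y → (0 <ᵇ lastMove j y) ≡ true →
      touched none s (concat< W j) y ≡ true
    lastMove⇒touched (suc j) y l e
      rewrite touched-++ none s (concat< W j) (W j) with still j y in e₁
    ... | true  = touched-⊇ _ (stage j) (W j) y
      (lastMove⇒touched j y (proj₁ (kept-true (stage j) (stage (suc j)) y e₁)) e)
    ... | false = ¬kept⇒touched _ (stage j) (W j) y (subst (λ u → Live u y) (stage-suc j) l)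
      (trans (cong (λ u → kept (stage j) u y) (sym (stage-suc j))) e₁)

    -- Charging each round afresh omits the first relocation in the round of a ball touched earlier;
    -- `recost-relocated` restores one per crossing. This superadditivity makes the levels add up.
    recost-rounds : ∀ n → ∑ n (λ j → recost none (stage j) (W j)) + crossings n
                          ≤ recost none s (concat< W n)
    recost-rounds zero    = z≤n
    recost-rounds (suc n) = begin
      (∑ n g + g n) + (crossings n + c)   ≡⟨ interchange (∑ n g) (g n) (crossings n) c ⟩
      (∑ n g + crossings n) + (g n + c)
        ≤⟨ +-mono-≤ (recost-rounds n) (≤-trans (+-monoʳ-≤ (g n) c≤) (recost-relocated T (stage n) (W n))) ⟩
      recost none s (concat< W n) + recost T (stage n) (W n)
        ≡⟨ recost-++ none s (concat< W n) (W n) ⟨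
      recost none s (concat< W (suc n)) ∎
      where
      open ≤-Reasoning
      g : ℕ → ℕ
      g j = recost none (stage j) (W j)
      T = touched none s (concat< W n)
      c = relocated (λ y → 0 <ᵇ lastMove n y) (stage n) (stage (suc n))
      c≤ : c ≤ relocated T (stage n) (run (stage n) (W n))
      c≤ = subst (λ u → c ≤ relocated T (stage n) u) (stage-suc n)
        (relocated-≤ (stage n) (stage (suc n)) (lastMove⇒touched n))

-- Sums over bit words, and addition of states

∑ᵛ : ∀ i → (Vec Bool i → ℕ) → ℕ
∑ᵛ zero    F = F []
∑ᵛ (suc i) F = ∑ᵛ i (F ∘ (true ∷_)) + ∑ᵛ i (F ∘ (false ∷_))

∑ᵛ-mono : ∀ i {F G : Vec Bool i → ℕ} → (∀ ε → F ε ≤ G ε) → ∑ᵛ i F ≤ ∑ᵛ i G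
∑ᵛ-mono zero    h = h []
∑ᵛ-mono (suc i) h = +-mono-≤ (∑ᵛ-mono i (h ∘ (true ∷_))) (∑ᵛ-mono i (h ∘ (false ∷_)))

∑ᵛ-+ : ∀ i (F G : Vec Bool i → ℕ) → ∑ᵛ i (λ ε → F ε + G ε) ≡ ∑ᵛ i F + ∑ᵛ i G
∑ᵛ-+ zero    F G = refl
∑ᵛ-+ (suc i) F G = trans (cong₂ _+_ (∑ᵛ-+ i _ _) (∑ᵛ-+ i _ _))
  (interchange (∑ᵛ i (F ∘ (true ∷_))) (∑ᵛ i (G ∘ (true ∷_))) _ _)

∑ᵛ-const : ∀ i c → ∑ᵛ i (λ _ → c) ≡ 2 ^ i * c
∑ᵛ-const zero    c = sym (+-identityʳ c)
∑ᵛ-const (suc i) c = trans (cong₂ _+_ (∑ᵛ-const i c) (∑ᵛ-const i c))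
  (solve 2 (λ a c → a :* c :+ a :* c := (a :+ (a :+ con 0)) :* c) refl (2 ^ i) c)
  where open +-*-Solver

∑ᵛ-∑ : ∀ i n (g : Vec Bool i → ℕ → ℕ) → ∑ᵛ i (λ ε → ∑ n (g ε)) ≡ ∑ n (λ j → ∑ᵛ i (λ ε → g ε j))
∑ᵛ-∑ i zero    g = trans (∑ᵛ-const i 0) (*-zeroʳ (2 ^ i))
∑ᵛ-∑ i (suc n) g = trans (∑ᵛ-+ i (λ ε → ∑ n (g ε)) (λ ε → g ε n)) (cong (_+ ∑ᵛ i (λ ε → g ε n)) (∑ᵛ-∑ i n g))

infixl 6 _⊕_
_⊕_ : State → State → State
(p , q) ⊕ (a , b) = p + a , q + b

⊕-assoc : ∀ s t u → s ⊕ t ⊕ u ≡ s ⊕ (t ⊕ u)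
⊕-assoc (p , q) (a , b) (c , d) = cong₂ _,_ (+-assoc p a c) (+-assoc q b d)

⊕-identityʳ : ∀ s → s ⊕ (0 , 0) ≡ s
⊕-identityʳ (p , q) = cong₂ _,_ (+-identityʳ p) (+-identityʳ q)

#bins-⊕ : ∀ s t → #bins (s ⊕ t) ≡ #bins s + #bins t
#bins-⊕ (p , q) (a , b) = interchange p a q b

size-⊕ : ∀ s t k → size (s ⊕ t) k ≡ size s k + size t k
size-⊕ (p , q) (a , b) insertA = refl
size-⊕ (p , q) (a , b) insertB = refl

run-replicateA : ∀ k s → run s (replicate k insertA) ≡ s ⊕ (k , 0)
run-replicateA zero    s       = sym (⊕-identityʳ s)
run-replicateA (suc k) (p , q) = trans (run-replicateA k (suc p , q)) (cong₂ _,_ (sym (+-suc p k)) refl)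

run-replicateB : ∀ k s → run s (replicate k insertB) ≡ s ⊕ (0 , k)
run-replicateB zero    s       = sym (⊕-identityʳ s)
run-replicateB (suc k) (p , q) = trans (run-replicateB k (p , suc q)) (cong₂ _,_ refl (sym (+-suc q k)))

-- The recursive blocks

module Blocks (L : ℕ) where

  -- The number of blocks of level 0 in a block of level i.
  M : ℕ → ℕ
  M i = (4 * L) ^ i

  -- How many of the first `j` rounds lie in the first and in the second half of the `4 * L` rounds.
  early late : ℕ → ℕ
  early j = 2 * L ⊓ j
  late  j = j ∸ 2 * L

  -- The bits are one per level, shared by all blocks of that level. `x` and `y` count the
  -- insertions in units of `M i`. They shift by one per level, so `pred` never truncates when
  -- `i ≤ x` and `i ≤ y`.
  block : ∀ i → ℕ → ℕ → Vec Bool i → List Insertion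
  subblock : ∀ i → ℕ → ℕ → Bool → Vec Bool i → ℕ → List Insertion

  block zero    x y []      = replicate x insertA ++ replicate y insertB
  block (suc i) x y (e ∷ ε) = concat< (subblock i x y e ε) (4 * L)

  subblock i x y e ε j =
    if (if e then j <ᵇ 2 * L else not (j <ᵇ 2 * L))
    then block i (suc x) (pred y) ε
    else block i (pred x) (suc y) ε

  heavyA heavyB : Bool → ℕ → ℕ
  heavyA e j = if e then early j else late j
  heavyB e j = if e then late j else early j

  private
    early-< : ∀ {j} → j < 2 * L → early (suc j) ≡ suc (early j)
    early-< {j} l = trans (m≥n⇒m⊓n≡n l) (cong suc (sym (m≥n⇒m⊓n≡n (<⇒≤ l))))

    late-< : ∀ {j} → j < 2 * L → late (suc j) ≡ late j
    late-< {j} l = trans (m≤n⇒m∸n≡0 l) (sym (m≤n⇒m∸n≡0 (<⇒≤ l)))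

    early-≮ : ∀ {j} → ¬ j < 2 * L → early (suc j) ≡ early j
    early-≮ {j} l = trans (m≤n⇒m⊓n≡m (m≤n⇒m≤1+n (≮⇒≥ l))) (sym (m≤n⇒m⊓n≡m (≮⇒≥ l)))

    late-≮ : ∀ {j} → ¬ j < 2 * L → late (suc j) ≡ suc (late j)
    late-≮ {j} l = +-∸-assoc 1 (≮⇒≥ l)

  early+late : ∀ j → early j + late j ≡ j
  early+late j = m⊓n+n∸m≡n (2 * L) j

  -- For a block with parameters `suc x` and `suc y`: a subblock has `x` or `suc (suc x)` units of
  -- a, so every round gives `x` and a heavy one 2 more; likewise for b.
  progress : (x y : ℕ) → ℕ → Bool → ℕ → State
  progress x y m e j = (j * x + 2 * heavyA e j) * m , (j * y + 2 * heavyB e j) * m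

  private
    gain : ∀ c z k m → (c * z + 2 * k) * m + suc (suc z) * m ≡ ((z + c * z) + 2 * suc k) * m
    gain = solve 4 (λ c z k m → (c :* z :+ con 2 :* k) :* m :+ (con 2 :+ z) :* m
                     := ((z :+ c :* z) :+ con 2 :* (con 1 :+ k)) :* m) refl
      where open +-*-Solver

    keep : ∀ c z k m → (c * z + 2 * k) * m + z * m ≡ ((z + c * z) + 2 * k) * m
    keep = solve 4 (λ c z k m → (c :* z :+ con 2 :* k) :* m :+ z :* m
                     := ((z :+ c :* z) :+ con 2 :* k) :* m) refl
      where open +-*-Solver

  -- Half of the subblocks gain one unit of a and the other half lose one, in either order, so the
  -- end state is independent of the bits.
  run-block : ∀ i x y ε s → i ≤ x → i ≤ y → run s (block i x y ε) ≡ s ⊕ (x * M i , y * M i)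
  run-subblocks : ∀ i x y e ε s j → i ≤ x → i ≤ y →
    run s (concat< (subblock i (suc x) (suc y) e ε) j) ≡ s ⊕ progress x y (M i) e j

  run-block zero x y [] s _ _ = begin
    run s (replicate x insertA ++ replicate y insertB)
      ≡⟨ run-++ s (replicate x insertA) _ ⟩
    run (run s (replicate x insertA)) (replicate y insertB)
      ≡⟨ cong (λ u → run u (replicate y insertB)) (run-replicateA x s) ⟩
    run (s ⊕ (x , 0)) (replicate y insertB)
      ≡⟨ run-replicateB y _ ⟩
    s ⊕ (x , 0) ⊕ (0 , y)
      ≡⟨ ⊕-assoc s (x , 0) (0 , y) ⟩
    s ⊕ (x + 0 , y)
      ≡⟨ cong (s ⊕_) (cong₂ _,_ (trans (+-identityʳ x) (sym (*-identityʳ x))) (sym (*-identityʳ y))) ⟩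
    s ⊕ (x * 1 , y * 1) ∎
    where open ≡-Reasoning
  run-block (suc i) (suc x) (suc y) (e ∷ ε) s (s≤s i≤x) (s≤s i≤y) =
    trans (run-subblocks i x y e ε s (4 * L) i≤x i≤y)
      (cong (s ⊕_) (cong₂ _,_ (total x _ (endA e)) (total y _ (endB e))))
    where
    total : ∀ x k → k ≡ 2 * L → (4 * L * x + 2 * k) * M i ≡ suc x * (4 * L * M i)
    total x k refl = solve 3 (λ l x m → (con 4 :* l :* x :+ con 2 :* (con 2 :* l)) :* m
      := (con 1 :+ x) :* (con 4 :* l :* m)) refl L x (M i)
      where open +-*-Solver
    4L : 4 * L ≡ 2 * L + 2 * L
    4L = *-distribʳ-+ L 2 2
    early-end : early (4 * L) ≡ 2 * L
    early-end = m≤n⇒m⊓n≡m (subst (2 * L ≤_) (sym 4L) (m≤m+n (2 * L) (2 * L)))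
    late-end : late (4 * L) ≡ 2 * L
    late-end = trans (cong (_∸ 2 * L) 4L) (m+n∸m≡n (2 * L) (2 * L))
    endA : ∀ e → heavyA e (4 * L) ≡ 2 * L
    endA true  = early-end
    endA false = late-end
    endB : ∀ e → heavyB e (4 * L) ≡ 2 * L
    endB true  = late-end
    endB false = early-end

  run-subblocks i x y true  ε s zero i≤x i≤y rewrite ⊓-zeroʳ (2 * L) | 0∸n≡0 (2 * L) = sym (⊕-identityʳ s)
  run-subblocks i x y false ε s zero i≤x i≤y rewrite ⊓-zeroʳ (2 * L) | 0∸n≡0 (2 * L) = sym (⊕-identityʳ s)
  run-subblocks i x y e ε s (suc j) i≤x i≤y = begin
    run s (concat< W j ++ W j)           ≡⟨ run-++ s (concat< W j) (W j) ⟩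
    run (run s (concat< W j)) (W j)      ≡⟨ cong (λ u → run u (W j)) (run-subblocks i x y e ε s j i≤x i≤y) ⟩
    run (s ⊕ progress x y (M i) e j) (W j) ≡⟨ step e ⟩
    s ⊕ progress x y (M i) e (suc j) ∎
    where
    open ≡-Reasoning
    W = subblock i (suc x) (suc y) e ε
    runA : ∀ u → run u (block i (suc (suc x)) y ε) ≡ u ⊕ (suc (suc x) * M i , y * M i)
    runA u = run-block i _ _ ε u (m≤n⇒m≤1+n (m≤n⇒m≤1+n i≤x)) i≤y
    runB : ∀ u → run u (block i x (suc (suc y)) ε) ≡ u ⊕ (x * M i , suc (suc y) * M i)
    runB u = run-block i _ _ ε u i≤x (m≤n⇒m≤1+n (m≤n⇒m≤1+n i≤y))
    moreA : ∀ k l → s ⊕ ((j * x + 2 * k) * M i , (j * y + 2 * l) * M i) ⊕ (suc (suc x) * M i , y * M i)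
      ≡ s ⊕ ((suc j * x + 2 * suc k) * M i , (suc j * y + 2 * l) * M i)
    moreA k l = trans (⊕-assoc s _ _) (cong (s ⊕_) (cong₂ _,_ (gain j x k (M i)) (keep j y l (M i))))
    moreB : ∀ k l → s ⊕ ((j * x + 2 * k) * M i , (j * y + 2 * l) * M i) ⊕ (x * M i , suc (suc y) * M i)
      ≡ s ⊕ ((suc j * x + 2 * k) * M i , (suc j * y + 2 * suc l) * M i)
    moreB k l = trans (⊕-assoc s _ _) (cong (s ⊕_) (cong₂ _,_ (keep j x k (M i)) (gain j y l (M i))))
    step : ∀ e → run (s ⊕ progress x y (M i) e j) (subblock i (suc x) (suc y) e ε j)
                 ≡ s ⊕ progress x y (M i) e (suc j)
    step true with j <? 2 * L
    ... | yes l rewrite <⇒<ᵇ≡true l | early-< l | late-< l = trans (runA _) (moreA (early j) (late j))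
    ... | no ¬l rewrite ≮⇒<ᵇ≡false ¬l | early-≮ ¬l | late-≮ ¬l = trans (runB _) (moreB (early j) (late j))
    step false with j <? 2 * L
    ... | yes l rewrite <⇒<ᵇ≡true l | early-< l | late-< l = trans (runB _) (moreB (late j) (early j))
    ... | no ¬l rewrite ≮⇒<ᵇ≡false ¬l | early-≮ ¬l | late-≮ ¬l = trans (runA _) (moreA (late j) (early j))

  -- For these `j`, `early j` exceeds `late j` by at least `L`, a lead of `2 * L` units, while one
  -- more round of the other order brings at most `z + 2`. So that order has not caught up even
  -- after round `j`.
  late-early : ∀ z j → z + 2 ≤ 2 * L → L ≤ j → j < 3 * L → z + 2 * late (suc j) ≤ 2 * early j
  late-early z j hz L≤j j<3L with j <? 2 * L
  ... | yes l = begin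
    z + 2 * late (suc j) ≡⟨ cong (λ k → z + 2 * k) (m≤n⇒m∸n≡0 l) ⟩
    z + 0                ≡⟨ +-identityʳ z ⟩
    z                    ≤⟨ m+n≤o⇒m≤o z hz ⟩
    2 * L                ≤⟨ *-monoʳ-≤ 2 L≤j ⟩
    2 * j                ≡⟨ cong (2 *_) (m≥n⇒m⊓n≡n (<⇒≤ l)) ⟨
    2 * early j          ∎
    where open ≤-Reasoning
  ... | no ¬l = begin
    z + 2 * late (suc j)   ≡⟨ cong (λ k → z + 2 * k) (late-≮ ¬l) ⟩
    z + 2 * suc (late j)   ≡⟨ cong (z +_) (*-suc 2 (late j)) ⟩
    z + (2 + 2 * late j)   ≡⟨ +-assoc z 2 _ ⟨
    z + 2 + 2 * late j     ≤⟨ +-mono-≤ hz (*-monoʳ-≤ 2 (≤-trans (∸-monoˡ-≤ (2 * L) (<⇒≤ j<3L))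
      (≤-reflexive (trans (cong (_∸ 2 * L) (*-distribʳ-+ L 2 1)) (trans (m+n∸m≡n (2 * L) (1 * L)) (*-identityˡ L)))))) ⟩
    2 * L + 2 * L          ≡⟨ solve 1 (λ l → con 2 :* l :+ con 2 :* l := con 2 :* (con 2 :* l)) refl L ⟩
    2 * (2 * L)            ≡⟨ cong (2 *_) (m≤n⇒m⊓n≡m (≮⇒≥ ¬l)) ⟨
    2 * early j            ∎
    where
    open ≤-Reasoning
    open +-*-Solver

  #bins-progress : ∀ x y m e j → suc x + suc y ≡ 2 * L → #bins (progress x y m e j) ≡ j * (2 * L * m)
  #bins-progress x y m e j xy = begin
    (j * x + 2 * heavyA e j) * m + (j * y + 2 * heavyB e j) * m
      ≡⟨ solve 6 (λ j x y m a b → (j :* x :+ con 2 :* a) :* m :+ (j :* y :+ con 2 :* b) :* m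
           := (j :* (x :+ y) :+ con 2 :* (a :+ b)) :* m) refl j x y m (heavyA e j) (heavyB e j) ⟩
    (j * (x + y) + 2 * (heavyA e j + heavyB e j)) * m
      ≡⟨ cong (λ k → (j * (x + y) + 2 * k) * m) (both e) ⟩
    (j * (x + y) + 2 * j) * m
      ≡⟨ solve 4 (λ j x y m → (j :* (x :+ y) :+ con 2 :* j) :* m
           := j :* (((con 1 :+ x) :+ (con 1 :+ y)) :* m)) refl j x y m ⟩
    j * ((suc x + suc y) * m)
      ≡⟨ cong (λ k → j * (k * m)) xy ⟩
    j * (2 * L * m) ∎
    where
    open ≡-Reasoning
    open +-*-Solver
    both : ∀ e → heavyA e j + heavyB e j ≡ j
    both true  = early+late j
    both false = trans (+-comm (late j) (early j)) (early+late j)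

  -- Cost of a block, level by level

  module Cost (f : Placement) where
    open Crossing f
    open Touching f

    -- This is `2 ^ i` times the expected charge for random bits.
    total : ∀ i → ℕ → ℕ → State → ℕ
    total i x y s = ∑ᵛ i (λ ε → recost none s (block i x y ε))

    -- The middle `2 * L` rounds are separated, so the balls arriving there force at least half as
    -- many crossings in both orders together; `recost-rounds` adds these to the charges within
    -- rounds.
    two-orders : ∀ i x y ε s → suc x + suc y ≡ 2 * L → i ≤ x → i ≤ y →
      let g = λ e j → recost none (s ⊕ progress x y (M i) e j) (subblock i (suc x) (suc y) e ε j) in
      (∑ (4 * L) (g true) + ∑ (4 * L) (g false)) + L * (2 * L * M i)
        ≤ recost none s (block (suc i) (suc x) (suc y) (true ∷ ε))
          + recost none s (block (suc i) (suc x) (suc y) (false ∷ ε))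
    two-orders i x y ε s xy i≤x i≤y = begin
      (∑ n (g true) + ∑ n (g false)) + L * w
        ≤⟨ +-monoʳ-≤ (∑ n (g true) + ∑ n (g false)) Lw≤X ⟩
      (∑ n (g true) + ∑ n (g false)) + (X₁ + X₂)
        ≡⟨ interchange (∑ n (g true)) (∑ n (g false)) X₁ X₂ ⟩
      (∑ n (g true) + X₁) + (∑ n (g false) + X₂)
        ≤⟨ +-mono-≤ (rounds true) (rounds false) ⟩
      recost none s (concat< (W true) n) + recost none s (concat< (W false) n) ∎
      where
      open ≤-Reasoning
      open +-*-Solver
      n w : ℕ
      n = 4 * L
      w = 2 * L * M i
      W : Bool → ℕ → List Insertion
      W e = subblock i (suc x) (suc y) e ε
      g : Bool → ℕ → ℕ
      g e j = recost none (s ⊕ progress x y (M i) e j) (W e j)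
      module Rd (e : Bool) = Rounds s (W e)
      st : Bool → ℕ → State
      st e = Rd.stage e
      st≡ : ∀ e j → st e j ≡ s ⊕ progress x y (M i) e j
      st≡ e j = run-subblocks i x y e ε s j i≤x i≤y
      X : Bool → ℕ
      X e = Run.crossings (st e) (Rd.stage-mono e) n
      X₁ = X true
      X₂ = X false
      rounds : ∀ e → ∑ n (g e) + X e ≤ recost none s (concat< (W e) n)
      rounds e = ≤-trans (+-monoˡ-≤ (X e) (≤-reflexive (∑-cong n (λ j _ →
        cong (λ u → recost none u (W e j)) (sym (st≡ e j)))))) (Rd.recost-rounds e n)
      bins : ∀ e j → #bins (st e j) ≡ #bins s + j * w
      bins e j = trans (cong #bins (st≡ e j)) (trans (#bins-⊕ s _)
        (cong (#bins s +_) (#bins-progress x y (M i) e j xy)))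
      end : st true n ≡ st false n
      end = trans (run-block (suc i) (suc x) (suc y) (true ∷ ε) s (s≤s i≤x) (s≤s i≤y))
        (sym (run-block (suc i) (suc x) (suc y) (false ∷ ε) s (s≤s i≤x) (s≤s i≤y)))
      open Separation f (st true) (st false) (Rd.stage-mono true) (Rd.stage-mono false) n refl end
        (λ j → trans (bins true j) (sym (bins false j)))
      size-st : ∀ e j k → size (st e j) k ≡ size s k + size (progress x y (M i) e j) k
      size-st e j k = trans (cong (λ u → size u k) (st≡ e j)) (size-⊕ s _ k)
      behind : ∀ z j c → z + 2 ≤ 2 * L → L ≤ j → j < 3 * L →
        c + (suc j * z + 2 * late (suc j)) * M i ≤ c + (j * z + 2 * early j) * M i
      behind z j c hz a b = +-monoʳ-≤ c (*-monoˡ-≤ (M i) (begin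
        z + j * z + 2 * late (suc j)    ≡⟨ solve 3 (λ z k l → z :+ k :+ l := k :+ (z :+ l)) refl z (j * z) _ ⟩
        j * z + (z + 2 * late (suc j))  ≤⟨ +-monoʳ-≤ (j * z) (late-early z j hz a b) ⟩
        j * z + 2 * early j ∎))
      x+2 : x + 2 ≤ 2 * L
      x+2 = subst (x + 2 ≤_) xy (≤-trans (≤-reflexive (+-comm x 2)) (s≤s
        (≤-trans (m≤m+n (suc x) y) (≤-reflexive (sym (+-suc x y))))))
      y+2 : y + 2 ≤ 2 * L
      y+2 = subst (y + 2 ≤_) xy (≤-trans (≤-reflexive (+-comm y 2)) (s≤s (m≤n+m (suc y) x)))
      sep : ∀ j → L ≤ j → j < 2 * L + L → Separated j
      sep j a b =
        subst₂ _≤_ (sym (size-st false (suc j) insertA)) (sym (size-st true j insertA))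
          (behind x j (size s insertA) x+2 a b′) ,
        subst₂ _≤_ (sym (size-st true (suc j) insertB)) (sym (size-st false j insertB))
          (behind y j (size s insertB) y+2 a b′)
        where
        b′ : j < 3 * L
        b′ = subst (j <_) (+-comm (2 * L) L) b
      Lw≤X : L * w ≤ X₁ + X₂
      Lw≤X = *-cancelˡ-≤ 2 (+-cancelˡ-≤ (#bins s + L * w) _ _ (begin
        #bins s + L * w + 2 * (L * w)
          ≡⟨ solve 3 (λ b l w → b :+ l :* w :+ con 2 :* (l :* w) := b :+ (con 2 :* l :+ l) :* w) refl (#bins s) L w ⟩
        #bins s + (2 * L + L) * w      ≡⟨ bins true (2 * L + L) ⟨
        #bins (st true (2 * L + L))
          ≤⟨ crossings-separated L (2 * L) (≤-trans (≤-reflexive (+-comm (2 * L) L)) (*-monoˡ-≤ L (n≤1+n 3))) sep ⟩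
        #bins (st true L) + 2 * (X₁ + X₂) ≡⟨ cong (_+ 2 * (X₁ + X₂)) (bins true L) ⟩
        #bins s + L * w + 2 * (X₁ + X₂) ∎))

    -- A level gains `L * w` over two orders of `4 * L * w` insertions each, hence the 8. The
    -- induction needs arbitrary `s`, `x` and `y`, as subblocks start anywhere with shifted
    -- parameters, but the bound depends on `x + y` only.
    total-≥ : ∀ i x y s → x + y ≡ 2 * L → i ≤ x → i ≤ y → i * 2 ^ i * (2 * L * M i) ≤ 8 * total i x y s
    total-≥ zero    x       y       s xy _ _ = z≤n
    total-≥ (suc i) (suc x) (suc y) s xy (s≤s i≤x) (s≤s i≤y) = begin
      suc i * (2 * 2 ^ i) * (2 * L * (4 * L * M i))
        ≡⟨ solve 4 (λ i t l m → (con 1 :+ i) :* (con 2 :* t) :* (con 2 :* l :* (con 4 :* l :* m))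
             := (con 4 :* l :* (i :* t :* (con 2 :* l :* m)) :+ con 4 :* l :* (i :* t :* (con 2 :* l :* m)))
                :+ con 8 :* (t :* (l :* (con 2 :* l :* m)))) refl i (2 ^ i) L (M i) ⟩
      (4 * L * c + 4 * L * c) + 8 * (2 ^ i * (L * w))
        ≤⟨ +-monoˡ-≤ (8 * (2 ^ i * (L * w))) (+-mono-≤ (subblocks true) (subblocks false)) ⟩
      (8 * G true + 8 * G false) + 8 * (2 ^ i * (L * w))
        ≡⟨ solve 3 (λ a b c → (con 8 :* a :+ con 8 :* b) :+ con 8 :* c := con 8 :* (a :+ b :+ c))
             refl (G true) (G false) (2 ^ i * (L * w)) ⟩
      8 * (G true + G false + 2 ^ i * (L * w))
        ≡⟨ cong (8 *_) (trans (∑ᵛ-+ i _ _) (cong₂ _+_ (∑ᵛ-+ i _ _) (∑ᵛ-const i (L * w)))) ⟨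
      8 * ∑ᵛ i (λ ε → (∑ (4 * L) (g ε true) + ∑ (4 * L) (g ε false)) + L * w)
        ≤⟨ *-monoʳ-≤ 8 (∑ᵛ-mono i (λ ε → two-orders i x y ε s xy i≤x i≤y)) ⟩
      8 * ∑ᵛ i (λ ε → recost none s (block (suc i) (suc x) (suc y) (true ∷ ε))
                     + recost none s (block (suc i) (suc x) (suc y) (false ∷ ε)))
        ≡⟨ cong (8 *_) (∑ᵛ-+ i _ _) ⟩
      8 * total (suc i) (suc x) (suc y) s ∎
      where
      open ≤-Reasoning
      open +-*-Solver
      w c : ℕ
      w = 2 * L * M i
      c = i * 2 ^ i * w
      g : Vec Bool i → Bool → ℕ → ℕ
      g ε e j = recost none (s ⊕ progress x y (M i) e j) (subblock i (suc x) (suc y) e ε j)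
      G : Bool → ℕ
      G e = ∑ᵛ i (λ ε → ∑ (4 * L) (g ε e))
      total-A : ∀ u → c ≤ 8 * total i (suc (suc x)) y u
      total-A u = total-≥ i (suc (suc x)) y u (trans (cong suc (sym (+-suc x y))) xy)
        (m≤n⇒m≤1+n (m≤n⇒m≤1+n i≤x)) i≤y
      total-B : ∀ u → c ≤ 8 * total i x (suc (suc y)) u
      total-B u = total-≥ i x (suc (suc y)) u (trans (+-suc x (suc y)) xy)
        i≤x (m≤n⇒m≤1+n (m≤n⇒m≤1+n i≤y))
      one : ∀ e j → c ≤ 8 * ∑ᵛ i (λ ε → g ε e j)
      one true j with j <ᵇ 2 * L
      ... | true  = total-A (s ⊕ progress x y (M i) true j)
      ... | false = total-B (s ⊕ progress x y (M i) true j)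
      one false j with j <ᵇ 2 * L
      ... | true  = total-B (s ⊕ progress x y (M i) false j)
      ... | false = total-A (s ⊕ progress x y (M i) false j)
      subblocks : ∀ e → 4 * L * c ≤ 8 * G e
      subblocks e = begin
        4 * L * c                                  ≡⟨ ∑-const (4 * L) c ⟨
        ∑ (4 * L) (λ _ → c)                        ≤⟨ ∑-mono (4 * L) (λ j _ → one e j) ⟩
        ∑ (4 * L) (λ j → 8 * ∑ᵛ i (λ ε → g ε e j)) ≡⟨ ∑-* (4 * L) 8 _ ⟩
        8 * ∑ (4 * L) (λ j → ∑ᵛ i (λ ε → g ε e j)) ≡⟨ cong (8 *_) (∑ᵛ-∑ i (4 * L) (λ ε → g ε e)) ⟨
        8 * G e ∎

-- Instances

costFrom-++ : ∀ f s u v → costFrom f s (u ++ v) ≡ costFrom f s u + costFrom f (run s u) v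
costFrom-++ f s []      v = refl
costFrom-++ f s (i ∷ u) v = trans (cong (cost f i s +_) (costFrom-++ f (insert i s) u v))
  (sym (+-assoc (cost f i s) _ _))

run-count : ∀ {m} s (v : Vec Insertion m) →
  run s (toList v) ≡ s ⊕ (count (insertA ≟_) v , count (insertB ≟_) v)
run-count s       []            = sym (⊕-identityʳ s)
run-count (p , q) (insertA ∷ v) = trans (run-count (suc p , q) v) (cong₂ _,_ (sym (+-suc p _)) refl)
run-count (p , q) (insertB ∷ v) = trans (run-count (p , suc q) v) (cong₂ _,_ refl (sym (+-suc q _)))

#bins-run : ∀ s w → #bins (run s w) ≡ #bins s + length w
#bins-run s       []            = sym (+-identityʳ _)
#bins-run (p , q) (insertA ∷ w) = trans (#bins-run (suc p , q) w) (sym (+-suc (p + q) (length w)))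
#bins-run (p , q) (insertB ∷ w) = trans (#bins-run (p , suc q) w)
  (trans (cong (_+ length w) (+-suc p q)) (sym (+-suc (p + q) (length w))))

module _ {n : ℕ} (w : List Insertion) (run-w : run (0 , 0) w ≡ (n , n)) where

  private
    length-w : length w ≡ 2 * n
    length-w = trans (sym (#bins-run (0 , 0) w)) (trans (cong #bins run-w) (cong (n +_) (sym (+-identityʳ n))))

    vec : Vec Insertion (2 * n)
    vec = cast length-w (fromList w)

    toList-vec : toList vec ≡ w
    toList-vec = trans (toList-cast length-w (fromList w)) (toList∘fromList w)

    counts : (count (insertA ≟_) vec , count (insertB ≟_) vec) ≡ (n , n)
    counts = trans (sym (run-count (0 , 0) vec)) (trans (cong (run (0 , 0)) toList-vec) run-w)

  toInstance : Instance n
  toInstance = record { insertions = vec ; countA = cong proj₁ counts ; countB = cong proj₂ counts }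

  totalCost-toInstance : ∀ f → totalCost f toInstance ≡ costFrom f (0 , 0) w
  totalCost-toInstance f = cong (costFrom f (0 , 0)) toList-vec

module Words (L : ℕ) where
  open Blocks L public

  -- All `k` blocks reuse the same bits. The parameters `L` and `L` permit depth `L` and balance
  -- both types; the padding fills up to the required length.
  word : ℕ → ℕ → Vec Bool L → List Insertion
  word k r ε = concat< (λ _ → block L L L ε) k ++ (replicate r insertA ++ replicate r insertB)

  run-blocks : ∀ k ε s → run s (concat< (λ _ → block L L L ε) k) ≡ s ⊕ (k * (L * M L) , k * (L * M L))
  run-blocks zero    ε s = sym (⊕-identityʳ s)
  run-blocks (suc k) ε s = begin
    run s (concat< (λ _ → block L L L ε) k ++ block L L L ε)
      ≡⟨ run-++ s (concat< (λ _ → block L L L ε) k) _ ⟩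
    run (run s (concat< (λ _ → block L L L ε) k)) (block L L L ε)
      ≡⟨ run-block L L L ε _ ≤-refl ≤-refl ⟩
    run s (concat< (λ _ → block L L L ε) k) ⊕ (L * M L , L * M L)
      ≡⟨ cong (_⊕ (L * M L , L * M L)) (run-blocks k ε s) ⟩
    s ⊕ (k * (L * M L) , k * (L * M L)) ⊕ (L * M L , L * M L)
      ≡⟨ ⊕-assoc s _ _ ⟩
    s ⊕ (k * (L * M L) + L * M L , k * (L * M L) + L * M L)
      ≡⟨ cong (s ⊕_) (cong₂ _,_ (+-comm _ (L * M L)) (+-comm _ (L * M L))) ⟩
    s ⊕ (suc k * (L * M L) , suc k * (L * M L)) ∎
    where open ≡-Reasoning

  run-word : ∀ k r ε → run (0 , 0) (word k r ε) ≡ (k * (L * M L) + r , k * (L * M L) + r)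
  run-word k r ε = begin
    run (0 , 0) (word k r ε)
      ≡⟨ run-++ (0 , 0) (concat< (λ _ → block L L L ε) k) _ ⟩
    run (run (0 , 0) (concat< (λ _ → block L L L ε) k)) (replicate r insertA ++ replicate r insertB)
      ≡⟨ cong (λ u → run u (replicate r insertA ++ replicate r insertB)) (run-blocks k ε (0 , 0)) ⟩
    run (m , m) (replicate r insertA ++ replicate r insertB)
      ≡⟨ run-++ (m , m) (replicate r insertA) _ ⟩
    run (run (m , m) (replicate r insertA)) (replicate r insertB)
      ≡⟨ cong (λ u → run u (replicate r insertB)) (run-replicateA r (m , m)) ⟩
    run (m + r , m + 0) (replicate r insertB)
      ≡⟨ run-replicateB r _ ⟩
    (m + r + 0 , m + 0 + r)
      ≡⟨ cong₂ _,_ (+-identityʳ (m + r)) (cong (_+ r) (+-identityʳ m)) ⟩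
    (m + r , m + r) ∎
    where
    open ≡-Reasoning
    m = k * (L * M L)

  cost-word : ∀ f k r → L * 2 ^ L * (2 * (k * (L * M L))) ≤ 8 * ∑ᵛ L (λ ε → costFrom f (0 , 0) (word k r ε))
  cost-word f k r = begin
    L * 2 ^ L * (2 * (k * (L * M L)))
      ≡⟨ solve 4 (λ l t k m → l :* t :* (con 2 :* (k :* (l :* m))) := k :* (l :* t :* (con 2 :* l :* m)))
           refl L (2 ^ L) k (M L) ⟩
    k * c
      ≡⟨ ∑-const k c ⟨
    ∑ k (λ _ → c)
      ≤⟨ ∑-mono k (λ j _ → total-≥ L L L (state j) (cong (L +_) (sym (+-identityʳ L))) ≤-refl ≤-refl) ⟩
    ∑ k (λ j → 8 * total L L L (state j))
      ≡⟨ ∑-* k 8 _ ⟩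
    8 * ∑ k (λ j → total L L L (state j))
      ≡⟨ cong (8 *_) (∑ᵛ-∑ L k (λ ε j → recost none (state j) (block L L L ε))) ⟨
    8 * ∑ᵛ L (λ ε → ∑ k (λ j → recost none (state j) (block L L L ε)))
      ≤⟨ *-monoʳ-≤ 8 (∑ᵛ-mono L blocks) ⟩
    8 * ∑ᵛ L (λ ε → costFrom f (0 , 0) (word k r ε)) ∎
    where
    open ≤-Reasoning
    open +-*-Solver
    open Crossing f
    open Touching f
    open Cost f
    c = L * 2 ^ L * (2 * L * M L)
    state : ℕ → State
    state j = (0 , 0) ⊕ (j * (L * M L) , j * (L * M L))
    blocks : ∀ ε → ∑ k (λ j → recost none (state j) (block L L L ε)) ≤ costFrom f (0 , 0) (word k r ε)
    blocks ε = begin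
      ∑ k (λ j → recost none (state j) (block L L L ε))
        ≡⟨ ∑-cong k (λ j _ → cong (λ u → recost none u (block L L L ε)) (run-blocks j ε (0 , 0))) ⟨
      ∑ k (λ j → recost none (run (0 , 0) (concat< (λ _ → block L L L ε) j)) (block L L L ε))
        -- The blocks serve as rounds of one long word; crossings between them are dropped.
        ≤⟨ m+n≤o⇒m≤o _ (Rounds.recost-rounds (0 , 0) (λ _ → block L L L ε) k) ⟩
      recost none (0 , 0) bs
        ≤⟨ recost-≤-costFrom none (0 , 0) bs ⟩
      costFrom f (0 , 0) bs
        ≤⟨ m≤m+n _ _ ⟩
      costFrom f (0 , 0) bs + costFrom f (run (0 , 0) bs) padding
        ≡⟨ costFrom-++ f (0 , 0) bs padding ⟨
      costFrom f (0 , 0) (word k r ε) ∎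
      where
      bs padding : List Insertion
      bs = concat< (λ _ → block L L L ε) k
      padding = replicate r insertA ++ replicate r insertB

-- Rational numbers

private
  _^ᵠ_ : ℚ → ℕ → ℚ
  _^ᵠ_ = Defs._^_

fromℕ≡fromℤ : ∀ n → fromℕ n ≡ fromℤ (+ᶻ n)
fromℕ≡fromℤ n = ℚₚ.↥p/↧p≡p (fromℤ (+ᶻ n))

fromℕ-+ : ∀ m n → fromℕ (m + n) ≡ fromℕ m ℚ.+ fromℕ n
fromℕ-+ m n = sym (trans (cong₂ ℚ._+_ (fromℕ≡fromℤ m) (fromℕ≡fromℤ n))
  (cong (ℚ._/ 1) (cong₂ ℤ._+_ (ℤₚ.*-identityʳ (+ᶻ m)) (ℤₚ.*-identityʳ (+ᶻ n)))))

fromℕ-* : ∀ m n → fromℕ (m * n) ≡ fromℕ m ℚ.* fromℕ n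
fromℕ-* m n = sym (trans (cong₂ ℚ._*_ (fromℕ≡fromℤ m) (fromℕ≡fromℤ n))
  (cong (ℚ._/ 1) (sym (ℤₚ.pos-* m n))))

fromℕ-^ : ∀ m n → fromℕ (m ^ n) ≡ fromℕ m ^ᵠ n
fromℕ-^ m zero    = refl
fromℕ-^ m (suc n) = trans (fromℕ-* m (m ^ n)) (cong (fromℕ m ℚ.*_) (fromℕ-^ m n))

fromℕ-mono : ∀ {m n} → m ≤ n → fromℕ m ℚ.≤ fromℕ n
fromℕ-mono {m} {n} m≤n = subst₂ ℚ._≤_ (sym (fromℕ≡fromℤ m)) (sym (fromℕ≡fromℤ n))
  (*≤* (ℤₚ.*-monoʳ-≤-nonNeg (+ᶻ 1) (+≤+ m≤n)))

fromℕ-cancel : ∀ {m n} → fromℕ m ℚ.≤ fromℕ n → m ≤ n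
fromℕ-cancel {m} {n} le with subst₂ ℚ._≤_ (fromℕ≡fromℤ m) (fromℕ≡fromℤ n) le
... | *≤* h = ℤₚ.drop‿+≤+ (subst₂ ℤ._≤_ (ℤₚ.*-identityʳ (+ᶻ m)) (ℤₚ.*-identityʳ (+ᶻ n)) h)

fromℕ-nonNeg : ∀ n → ℚ.NonNegative (fromℕ n)
fromℕ-nonNeg n = ℚ.nonNegative (fromℕ-mono {0} {n} z≤n)

^-nonNeg : ∀ p k → ℚ.NonNegative p → ℚ.NonNegative (p ^ᵠ k)
^-nonNeg p zero    _  = _
^-nonNeg p (suc k) p≥0 = ℚₚ.nonNeg*nonNeg⇒nonNeg p ⦃ p≥0 ⦄ (p ^ᵠ k) ⦃ ^-nonNeg p k p≥0 ⦄

*-mono : ∀ {p q r s} → ℚ.NonNegative p → ℚ.NonNegative s → p ℚ.≤ q → r ℚ.≤ s → p ℚ.* r ℚ.≤ q ℚ.* s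
*-mono {p} {q} {r} {s} p≥0 s≥0 p≤q r≤s = ℚₚ.≤-trans
  (ℚₚ.*-monoˡ-≤-nonNeg p ⦃ p≥0 ⦄ r≤s) (ℚₚ.*-monoʳ-≤-nonNeg s ⦃ s≥0 ⦄ p≤q)

^-mono : ∀ {p q} k → ℚ.NonNegative p → p ℚ.≤ q → p ^ᵠ k ℚ.≤ q ^ᵠ k
^-mono zero    _   _   = ℚₚ.≤-refl
^-mono {p} {q} (suc k) p≥0 p≤q = *-mono p≥0
  (^-nonNeg q k (ℚ.nonNegative (ℚₚ.≤-trans (ℚₚ.nonNegative⁻¹ p ⦃ p≥0 ⦄) p≤q)))
  p≤q (^-mono k p≥0 p≤q)

½^-≤1 : ∀ k → ½ ^ᵠ k ℚ.≤ 1ℚ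
½^-≤1 zero    = ℚₚ.≤-refl
½^-≤1 (suc k) = *-mono {½} {1ℚ} _ _ (toWitness {a? = ½ ℚₚ.≤? 1ℚ} _) (½^-≤1 k)

½^suc-<1 : ∀ k → ½ ^ᵠ suc k ℚ.< 1ℚ
½^suc-<1 k = ℚₚ.≤-<-trans (ℚₚ.*-monoˡ-≤-nonNeg ½ (½^-≤1 k)) (toWitness {a? = (½ ℚ.* 1ℚ) ℚₚ.<? 1ℚ} _)

½^-inverse : ∀ k → ½ ^ᵠ k ℚ.* fromℕ (2 ^ k) ≡ 1ℚ
½^-inverse zero    = refl
½^-inverse (suc k) = begin
  ½ ℚ.* (½ ^ᵠ k) ℚ.* fromℕ (2 * 2 ^ k)          ≡⟨ cong (½ ℚ.* (½ ^ᵠ k) ℚ.*_) (fromℕ-* 2 (2 ^ k)) ⟩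
  ½ ℚ.* (½ ^ᵠ k) ℚ.* (fromℕ 2 ℚ.* fromℕ (2 ^ k)) ≡⟨ ℚ-interchange ½ (½ ^ᵠ k) (fromℕ 2) (fromℕ (2 ^ k)) ⟩
  ½ ℚ.* fromℕ 2 ℚ.* (½ ^ᵠ k ℚ.* fromℕ (2 ^ k))  ≡⟨ cong (½ ℚ.* fromℕ 2 ℚ.*_) (½^-inverse k) ⟩
  1ℚ ∎
  where
  open ≡-Reasoning
  open CommutativeMonoid ℚₚ.*-1-commutativeMonoid using (commutativeSemigroup)
  open import Algebra.Properties.CommutativeSemigroup commutativeSemigroup
    renaming (interchange to ℚ-interchange)

-- Logarithms

2^-cancel-≤ : ∀ i k → 2 ^ i ≤ 2 ^ k → i ≤ k
2^-cancel-≤ i k le = ≮⇒≥ (λ k<i → <⇒≱ (^-monoʳ-< 2 ≤-refl k<i) le)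

-- For `u = i / d` with `i ≥ 0`, the chain `2 ^ i ≤ n ^ d ≤ 2 ^ (k * d)` gives `i ≤ k * d`; a
-- negative `u` lies below `k` anyway.
≤log₂-upper : ∀ {n k} u → n ≤ 2 ^ k → u ≤log₂ fromℕ n → u ℚ.≤ fromℕ k
≤log₂-upper {n} {k} u@(mkℚ (+ᶻ i) d-1 _) n≤ le = subst (u ℚ.≤_) (sym (fromℕ≡fromℤ k))
  (*≤* (subst₂ ℤ._≤_ (sym (ℤₚ.*-identityʳ (+ᶻ i))) (ℤₚ.pos-* k d) (+≤+ i≤kd)))
  where
  d = suc d-1
  i≤kd : i ≤ k * d
  i≤kd = 2^-cancel-≤ i (k * d) (≤-trans
    (fromℕ-cancel {2 ^ i} {n ^ d} (subst₂ ℚ._≤_ (sym (fromℕ-^ 2 i)) (sym (fromℕ-^ n d)) le))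
    (≤-trans (^-monoˡ-≤ d n≤) (≤-reflexive (^-*-assoc 2 k d))))
≤log₂-upper {n} {k} u@(mkℚ -[1+ i ] d-1 _) n≤ le = subst (u ℚ.≤_) (sym (fromℕ≡fromℤ k))
  (*≤* (subst₂ ℤ._≤_ (sym (ℤₚ.*-identityʳ -[1+ i ])) (ℤₚ.pos-* k (suc d-1)) -≤+))

-- Dual to `≤log₂-upper`. A negative `v` would force a power of `x` below 1, although `x` is at
-- least `2 ^ l ≥ 1`.
log₂-lower : ∀ {x} l v → fromℕ (2 ^ l) ℚ.≤ x → log₂ x ≤ v → fromℕ l ℚ.≤ v
log₂-lower {x} l v@(mkℚ (+ᶻ i) d-1 _) l≤ le = subst (ℚ._≤ v) (sym (fromℕ≡fromℤ l))
  (*≤* (subst₂ ℤ._≤_ (ℤₚ.pos-* l d) (sym (ℤₚ.*-identityʳ (+ᶻ i))) (+≤+ ld≤i)))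
  where
  d = suc d-1
  ld≤i : l * d ≤ i
  ld≤i = 2^-cancel-≤ (l * d) i (≤-trans (≤-reflexive (sym (^-*-assoc 2 l d)))
    (fromℕ-cancel {(2 ^ l) ^ d} {2 ^ i} (subst₂ ℚ._≤_ (sym (fromℕ-^ (2 ^ l) d)) (sym (fromℕ-^ 2 i))
      (ℚₚ.≤-trans (^-mono d (fromℕ-nonNeg (2 ^ l)) l≤) le))))
log₂-lower {x} l (mkℚ -[1+ i ] d-1 _) l≤ le = contradiction 
  (ℚₚ.≤-<-trans (ℚₚ.≤-trans one (ℚₚ.≤-trans (^-mono d (fromℕ-nonNeg (2 ^ l)) l≤) le)) (½^suc-<1 i))
  (ℚₚ.<-irrefl refl)
  where
  d = suc d-1
  one : 1ℚ ℚ.≤ fromℕ (2 ^ l) ^ᵠ d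
  one = subst (1ℚ ℚ.≤_) (fromℕ-^ (2 ^ l) d) (fromℕ-mono {1} {(2 ^ l) ^ d}
    (≤-trans (m^n>0 2 (l * d)) (≤-reflexive (sym (^-*-assoc 2 l d)))))

-- Uniform distributions on words of bits

leaves : ∀ {A : Set} i → (Vec Bool i → A) → List A
leaves zero    F = F [] ∷ []
leaves (suc i) F = leaves i (F ∘ (true ∷_)) ++ leaves i (F ∘ (false ∷_))

sum-++ : ∀ xs ys → Defs.sum (xs ++ ys) ≡ Defs.sum xs ℚ.+ Defs.sum ys
sum-++ []       ys = sym (ℚₚ.+-identityˡ _)
sum-++ (x ∷ xs) ys = trans (cong (x ℚ.+_) (sum-++ xs ys)) (sym (ℚₚ.+-assoc x _ _))

sum-leaves : ∀ {A : Set} i (F : Vec Bool i → A) (h : A → ℚ) w (g : Vec Bool i → ℕ) →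
  (∀ ε → h (F ε) ≡ w ℚ.* fromℕ (g ε)) → Defs.sum (map h (leaves i F)) ≡ w ℚ.* fromℕ (∑ᵛ i g)
sum-leaves zero    F h w g e = trans (ℚₚ.+-identityʳ _) (e [])
sum-leaves (suc i) F h w g e = begin
  Defs.sum (map h (leaves i F₁ ++ leaves i F₂))
    ≡⟨ cong Defs.sum (map-++ h (leaves i F₁) _) ⟩
  Defs.sum (map h (leaves i F₁) ++ map h (leaves i F₂))
    ≡⟨ sum-++ (map h (leaves i F₁)) _ ⟩
  Defs.sum (map h (leaves i F₁)) ℚ.+ Defs.sum (map h (leaves i F₂))
    ≡⟨ cong₂ ℚ._+_ (sum-leaves i F₁ h w _ (e ∘ (true ∷_))) (sum-leaves i F₂ h w _ (e ∘ (false ∷_))) ⟩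
  w ℚ.* fromℕ (∑ᵛ i _) ℚ.+ w ℚ.* fromℕ (∑ᵛ i _)
    ≡⟨ ℚₚ.*-distribˡ-+ w _ _ ⟨
  w ℚ.* (fromℕ (∑ᵛ i _) ℚ.+ fromℕ (∑ᵛ i _))
    ≡⟨ cong (w ℚ.*_) (fromℕ-+ (∑ᵛ i _) _) ⟨
  w ℚ.* fromℕ (∑ᵛ (suc i) g) ∎
  where
  open ≡-Reasoning
  F₁ = F ∘ (true ∷_)
  F₂ = F ∘ (false ∷_)

All-leaves : ∀ {A : Set} {P : A → Set} i (F : Vec Bool i → A) → (∀ ε → P (F ε)) → All P (leaves i F)
All-leaves zero    F h = h [] ∷ []
All-leaves (suc i) F h = ++⁺ (All-leaves i _ (h ∘ (true ∷_))) (All-leaves i _ (h ∘ (false ∷_)))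

uniform : ∀ {A : Set} i → (Vec Bool i → A) → Distribution A
uniform i F = record
  { outcomes    = leaves i (λ ε → ½ ^ᵠ i , F ε)
  ; nonNegative = All-leaves i _ (λ _ → ℚₚ.nonNegative⁻¹ _ ⦃ ^-nonNeg ½ i _ ⦄)
  ; total       = trans (sum-leaves i _ proj₁ (½ ^ᵠ i) (λ _ → 1) (λ _ → sym (ℚₚ.*-identityʳ _)))
                    (trans (cong (λ m → ½ ^ᵠ i ℚ.* fromℕ m) (trans (∑ᵛ-const i 1) (*-identityʳ (2 ^ i))))
                           (½^-inverse i))
  }

expectation-uniform : ∀ {A : Set} i (F : Vec Bool i → A) X →
  expectation (uniform i F) X ≡ ½ ^ᵠ i ℚ.* fromℕ (∑ᵛ i (X ∘ F))
expectation-uniform i F X = sum-leaves i _ _ (½ ^ᵠ i) (X ∘ F) (λ _ → refl)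

-- Choice of the depth

between : (g : ℕ → ℕ) (n : ℕ) → g 0 ≤ n → ∀ k → n < g k → ∃[ r ] (g r ≤ n × n < g (suc r))
between g n lo zero    hi = contradiction lo (<⇒≱ hi)
between g n lo (suc k) hi with n <? g k
... | yes l = between g n lo k l
... | no ¬l = k , ≮⇒≥ ¬l , hi

n<2^n : ∀ n → n < 2 ^ n
n<2^n zero    = s≤s z≤n
n<2^n (suc n) = +-mono-≤ (m^n>0 2 n) (≤-trans (n<2^n n) (≤-reflexive (sym (+-identityʳ (2 ^ n)))))

-- For L = 2^r, a block of level L has 2^(exponent r) insertions of each type.
exponent : ℕ → ℕ
exponent r = r + (2 + r) * 2 ^ r

exponent-spec : ∀ r → 2 ^ r * (4 * 2 ^ r) ^ (2 ^ r) ≡ 2 ^ exponent r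
exponent-spec r = begin
  2 ^ r * (4 * 2 ^ r) ^ (2 ^ r)     ≡⟨ cong (λ m → 2 ^ r * m ^ (2 ^ r)) (sym (^-distribˡ-+-* 2 2 r)) ⟩
  2 ^ r * (2 ^ (2 + r)) ^ (2 ^ r)   ≡⟨ cong (2 ^ r *_) (^-*-assoc 2 (2 + r) (2 ^ r)) ⟩
  2 ^ r * 2 ^ ((2 + r) * 2 ^ r)     ≡⟨ ^-distribˡ-+-* 2 r ((2 + r) * 2 ^ r) ⟨
  2 ^ exponent r ∎
  where open ≡-Reasoning

exponent-lower : ∀ r → 2 ^ r ≤ exponent r
exponent-lower r = ≤-trans (m≤m+n (2 ^ r) ((1 + r) * 2 ^ r)) (m≤n+m _ r)

-- For `r = 1 + t` and `L = 2 ^ r` the right side is `10 * (r * L)`, which compares `L` with log n /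
-- log log n. Indices start at `r = 1`, as the bound would vanish at `r = 0`.
exponent-upper : ∀ t → exponent (2 + t) ≤ 10 * ((1 + t) * 2 ^ (1 + t))
exponent-upper t = begin
  (2 + t) + (4 + t) * (2 * P)
    ≤⟨ +-monoˡ-≤ _ (≤-trans (+-mono-≤ (*-monoʳ-≤ 2 1≤P) (≤-trans (≤-reflexive (sym (*-identityʳ t))) (*-monoʳ-≤ t 1≤P)))
         (m≤m+n (2 * P + t * P) (7 * (t * P)))) ⟩
  (2 * P + t * P + 7 * (t * P)) + (4 + t) * (2 * P)
    ≡⟨ solve 2 (λ t p → (con 2 :* p :+ t :* p :+ con 7 :* (t :* p)) :+ (con 4 :+ t) :* (con 2 :* p)
         := con 10 :* ((con 1 :+ t) :* p)) refl t P ⟩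
  10 * ((1 + t) * P) ∎
  where
  open ≤-Reasoning
  open +-*-Solver
  P = 2 ^ (1 + t)
  1≤P : 1 ≤ P
  1≤P = m^n>0 2 (1 + t)

-- The remainder is below `n`, and the quotient is at least 1. Padding after the last whole block
-- thus costs a factor of at most 2.
m≤2*[m/n]*n : ∀ m n .⦃ _ : NonZero n ⦄ → n ≤ m → m ≤ 2 * (m / n * n)
m≤2*[m/n]*n m n n≤m = begin
  m                       ≡⟨ m≡m%n+[m/n]*n m n ⟩
  m % n + m / n * n       ≤⟨ +-monoˡ-≤ (m / n * n) (≤-trans (<⇒≤ (m%n<n m n))
    (≤-trans (≤-reflexive (sym (*-identityˡ n))) (*-monoˡ-≤ n (m≥n⇒m/n>0 n≤m)))) ⟩
  m / n * n + m / n * n   ≡⟨ cong (m / n * n +_) (+-identityʳ (m / n * n)) ⟨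
  2 * (m / n * n) ∎
  where open ≤-Reasoning

rescale : ∀ {c h} → ℚ.NonNegative c → ℚ.NonNegative h → ∀ a b A B →
  c ℚ.* fromℕ a ≡ 1ℚ → h ℚ.* fromℕ b ≡ 1ℚ → b * A ≤ a * B →
  c ℚ.* fromℕ A ℚ.≤ h ℚ.* fromℕ B
rescale {c} {h} c≥0 h≥0 a b A B ca hb bA≤aB = begin
  c ℚ.* fromℕ A                          ≡⟨ ℚₚ.*-identityʳ _ ⟨
  c ℚ.* fromℕ A ℚ.* 1ℚ                   ≡⟨ cong (c ℚ.* fromℕ A ℚ.*_) hb ⟨
  c ℚ.* fromℕ A ℚ.* (h ℚ.* fromℕ b)      ≡⟨ solve 4 (λ c a h b → c :* a :* (h :* b) := c :* h :* (b :* a)) refl c (fromℕ A) h (fromℕ b) ⟩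
  c ℚ.* h ℚ.* (fromℕ b ℚ.* fromℕ A)      ≡⟨ cong (c ℚ.* h ℚ.*_) (fromℕ-* b A) ⟨
  c ℚ.* h ℚ.* fromℕ (b * A)
    ≤⟨ ℚₚ.*-monoˡ-≤-nonNeg (c ℚ.* h) ⦃ ℚₚ.nonNeg*nonNeg⇒nonNeg c ⦃ c≥0 ⦄ h ⦃ h≥0 ⦄ ⦄ (fromℕ-mono bA≤aB) ⟩
  c ℚ.* h ℚ.* fromℕ (a * B)              ≡⟨ cong (c ℚ.* h ℚ.*_) (fromℕ-* a B) ⟩
  c ℚ.* h ℚ.* (fromℕ a ℚ.* fromℕ B)      ≡⟨ solve 4 (λ c h a b → c :* h :* (a :* b) := c :* a :* (h :* b)) refl c h (fromℕ a) (fromℕ B) ⟩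
  c ℚ.* fromℕ a ℚ.* (h ℚ.* fromℕ B)      ≡⟨ cong (ℚ._* (h ℚ.* fromℕ B)) ca ⟩
  1ℚ ℚ.* (h ℚ.* fromℕ B)                 ≡⟨ ℚₚ.*-identityˡ _ ⟩
  h ℚ.* fromℕ B ∎
  where
  open ℚₚ.≤-Reasoning
  open ℚ-Solver.+-*-Solver

-- The hard distribution and its expected cost

module Final (n t : ℕ) (lower : 2 ^ exponent (1 + t) ≤ n) (upper : n < 2 ^ exponent (2 + t)) where

  private
    r L K k rest : ℕ
    r = 1 + t
    L = 2 ^ r

    open Words L

    K = 2 ^ exponent r

    instance
      K≢0 : NonZero K
      K≢0 = m^n≢0 2 (exponent r)

    k = n / K
    rest = n % K

    n≡ : k * (L * M L) + rest ≡ n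
    n≡ = trans (cong (λ m → k * m + rest) (exponent-spec r))
      (trans (+-comm (k * K) rest) (sym (m≡m%n+[m/n]*n n K)))

    balanced : ∀ ε → run (0 , 0) (word k rest ε) ≡ (n , n)
    balanced ε = trans (run-word k rest ε) (cong₂ _,_ n≡ n≡)

    inst : Vec Bool L → Instance n
    inst ε = toInstance (word k rest ε) (balanced ε)

  μ : Distribution (Instance n)
  μ = uniform L inst

  module _ (f : Placement) where

    private
      S : ℕ
      S = ∑ᵛ L (λ ε → totalCost f (inst ε))

      S-≥ : L * 2 ^ L * n ≤ 8 * S
      S-≥ = begin
        L * 2 ^ L * n                        ≤⟨ *-monoʳ-≤ (L * 2 ^ L) (m≤2*[m/n]*n n K lower) ⟩
        L * 2 ^ L * (2 * (k * K))            ≡⟨ cong (λ m → L * 2 ^ L * (2 * (k * m))) (exponent-spec r) ⟨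
        L * 2 ^ L * (2 * (k * (L * M L)))    ≤⟨ cost-word f k rest ⟩
        8 * ∑ᵛ L (λ ε → costFrom f (0 , 0) (word k rest ε))
          ≤⟨ *-monoʳ-≤ 8 (∑ᵛ-mono L (λ ε → ≤-reflexive (sym (totalCost-toInstance (word k rest ε) (balanced ε) f)))) ⟩
        8 * S ∎
        where open ≤-Reasoning

      E′ : ℕ
      E′ = exponent (2 + t)

      -- The constant 80 is the 8 of `S-≥` times the 10 of `exponent-upper`.
      key : 2 ^ L * (n * E′) ≤ 80 * (S * r)
      key = begin
        2 ^ L * (n * E′)               ≤⟨ *-monoʳ-≤ (2 ^ L) (*-monoʳ-≤ n (exponent-upper t)) ⟩
        2 ^ L * (n * (10 * (r * L)))
          ≡⟨ solve 4 (λ p n r l → p :* (n :* (con 10 :* (r :* l))) := con 10 :* r :* (l :* p :* n)) refl (2 ^ L) n r L ⟩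
        10 * r * (L * 2 ^ L * n)       ≤⟨ *-monoʳ-≤ (10 * r) S-≥ ⟩
        10 * r * (8 * S)
          ≡⟨ solve 2 (λ r s → con 10 :* r :* (con 8 :* s) := con 80 :* (s :* r)) refl r S ⟩
        80 * (S * r) ∎
        where
        open ≤-Reasoning
        open +-*-Solver

    expected-cost-≥ : (+ᶻ 1 ℚ./ 80) ·nlog/loglog n ≤ expectation μ (totalCost f)
    expected-cost-≥ u w v u≤ ≤w ≤v = begin
      c ℚ.* fromℕ n ℚ.* u
        ≤⟨ ℚₚ.*-monoˡ-≤-nonNeg (c ℚ.* fromℕ n) ⦃ ℚₚ.nonNeg*nonNeg⇒nonNeg c (fromℕ n) ⦃ fromℕ-nonNeg n ⦄ ⦄
             (≤log₂-upper {n} {E′} u (<⇒≤ upper) u≤) ⟩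
      c ℚ.* fromℕ n ℚ.* fromℕ E′
        ≡⟨ ℚₚ.*-assoc c (fromℕ n) (fromℕ E′) ⟩
      c ℚ.* (fromℕ n ℚ.* fromℕ E′)
        ≡⟨ cong (c ℚ.*_) (fromℕ-* n E′) ⟨
      c ℚ.* fromℕ (n * E′)
        ≤⟨ rescale {c} {h} _ h≥0 80 (2 ^ L) (n * E′) (S * r) refl (½^-inverse L) key ⟩
      h ℚ.* fromℕ (S * r)
        ≡⟨ cong (h ℚ.*_) (fromℕ-* S r) ⟩
      h ℚ.* (fromℕ S ℚ.* fromℕ r)
        ≡⟨ ℚₚ.*-assoc h (fromℕ S) (fromℕ r) ⟨
      h ℚ.* fromℕ S ℚ.* fromℕ r
        -- As `w` is at least `exponent r`, hence at least `2 ^ r`, its logarithm bound `v` is at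
        -- least `r`.
        ≤⟨ ℚₚ.*-monoˡ-≤-nonNeg (h ℚ.* fromℕ S) ⦃ ℚₚ.nonNeg*nonNeg⇒nonNeg h ⦃ h≥0 ⦄ (fromℕ S) ⦃ fromℕ-nonNeg S ⦄ ⦄
             (log₂-lower r v (ℚₚ.≤-trans (fromℕ-mono (exponent-lower r))
               (log₂-lower (exponent r) w (fromℕ-mono lower) ≤w)) ≤v) ⟩
      h ℚ.* fromℕ S ℚ.* v
        ≡⟨ cong (ℚ._* v) (expectation-uniform L inst (totalCost f)) ⟨
      expectation μ (totalCost f) ℚ.* v ∎
      where
      open ℚₚ.≤-Reasoning
      c h : ℚ
      c = +ᶻ 1 ℚ./ 80
      h = ½ ^ᵠ L
      h≥0 : ℚ.NonNegative h
      h≥0 = ^-nonNeg ½ L _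

window : ∀ n → 2 ^ exponent 1 ≤ n → ∃[ t ] (2 ^ exponent (1 + t) ≤ n × n < 2 ^ exponent (2 + t))
window n N≤n = between (λ t → 2 ^ exponent (1 + t)) n N≤n n (begin-strict
  n                     <⟨ n<2^n n ⟩
  2 ^ n                 ≤⟨ ^-monoʳ-≤ 2 (≤-trans (n≤1+n n) (m≤m+n (suc n) _)) ⟩
  2 ^ exponent (1 + n) ∎)
  where open ≤-Reasoning

theorem6p1 : Σ[ c ∈ ℚ ] (0ℚ ℚ.< c × Σ[ N ∈ ℕ ] (∀ (n : ℕ) → N ≤ n →
    Σ[ μ ∈ Distribution (Instance n) ] (∀ (f : Placement) →
    c ·nlog/loglog n ≤ expectation μ (totalCost f))))
theorem6p1 = +ᶻ 1 ℚ./ 80 , toWitness {a? = 0ℚ ℚₚ.<? (+ᶻ 1 ℚ./ 80)} _ , 2 ^ exponent 1 , λ n N≤n →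
  let t , lower , upper = window n N≤n in
  Final.μ n t lower upper , Final.expected-cost-≥ n t lower upper
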